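{- Let $n\ge 1$ and let $G$ be a subgroup of $S_n$ that is generated by elements $\sigma_1^{r_1},\sigma_2^{r_2},\dots,\sigma_t^{r_t}$, where $\sigma_1,\dots,\sigma_t$ are pairwise disjoint cycles in $S_n$ and $r_1,\dots,r_t$ are integers. Then the quotient poset $B_n/G$ is a symmetric chain order.
   Context: A finite poset $P$ is ranked if it has a minimum element $0_P$ and, for every $x\in P$, all saturated chains from $0_P$ to $x$ have the same length $r(x)$ (number of elements minus one); $r(P)=\max_x r(x)$. In a ranked poset a chain $x_1<x_2<\dots<x_k$ is symmetric if it is saturated (each $x_{i+1}$ covers $x_i$) and $r(x_1)+r(x_k)=r(P)$. A symmetric chain decomposition (SCD) of $P$ is a partition of $P$ into symmetric chains; $P$ is a symmetric chain order (SCO) if it has an SCD. $B_n$ is the Boolean lattice of all subsets of $[n]=\{1,\dots,n\}$ ordered by inclusion. $S_n$ acts on $B_n$ by $\sigma(A)=\{\sigma(a):a\in A\}$. For a subgroup $G\le S_n$, the quotient $B_n/G$ is the set of orbits $[A]=\{\sigma(A):\sigma\in G\}$, $A\in B_n$, ordered by $[A]\le[B]$ iff $X\subseteq Y$ for some $X\in[A]$, $Y\in[B]$; its rank function is $r([A])=|A|$. -}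

module Defs where

open import Algebra.Bundles using (Group)
import Algebra.Definitions.RawMonoid as RawMonoidDefinitions
import Algebra.Properties.CommutativeMonoid.Sum as Sum
open import Data.Bool.Base using (if_then_else_)
open import Data.Fin.Base using (Fin)
open import Data.Fin.Permutation as Perm
  using (Permutation′; _⟨$⟩ʳ_; _⟨$⟩ˡ_; _∘ₚ_; flip; inverseˡ; inverseʳ)
open import Data.Fin.Subset
  using (Subset; Side; inside; outside; _∈_; _⊆_; ∣_∣)
open import Data.Fin.Subset.Properties
  using (⊆-antisym; p⊆q⇒∣p∣≤∣q∣; p⊂q⇒∣p∣<∣q∣; _∈?_)
open import Data.Integer.Base using (ℤ; +_; -[1+_])
open import Data.List.Base using (List; []; _∷_; _∷ʳ_; map; length)
open import Data.List.Extrema.Nat using (max)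
import Data.List.Membership.Propositional as ListMembership
import Data.List.Membership.Setoid as SetoidMembership
open import Data.List.NonEmpty.Base using (List⁺; toList; head; tail; last)
open import Data.List.Relation.Binary.Disjoint.Setoid using (Disjoint)
open import Data.List.Relation.Unary.All using (All)
open import Data.List.Relation.Unary.AllPairs using (AllPairs)
open import Data.List.Relation.Unary.Any using (Any)
open import Data.List.Relation.Unary.Enumerates.Setoid using (IsEnumeration)
open import Data.List.Relation.Unary.Linked using (Linked)
open import Data.List.Relation.Unary.Unique.Propositional using (Unique)
open import Data.Nat.Base using (ℕ; suc; _+_; _≤_)
open import Data.Nat.Properties
  using (+-0-commutativeMonoid; ≤-trans; ≤-reflexive; <⇒≱)
open import Data.Product.Base using (Σ; ∃; ∃₂; _×_; _,_)
open import Data.Sum.Base using (_⊎_)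
open import Data.Vec.Base using ([]; _∷_; lookup; tabulate)
open import Data.Vec.Properties
  using (lookup∘tabulate; []=⇒lookup; lookup⇒[]=)
open import Function.Bundles using (_⇔_; mk⇔; Equivalence)
open import Level using (Level; 0ℓ; _⊔_) renaming (suc to lsuc)
open import Relation.Binary.Bundles using (Poset)
open import Relation.Binary.Core using (Rel)
open import Relation.Binary.Definitions using (Minimum)
import Relation.Binary.Properties.Poset as PosetProperties
open import Relation.Binary.PropositionalEquality
  using (_≡_; refl; sym; trans; cong; cong₂; subst; module ≡-Reasoning)
open import Relation.Nullary using (¬_; yes; no; contradiction)
open import Relation.Unary using (Pred; _≐_)

module _ {c ℓ : Level} (𝔾 : Group c ℓ) where
  open Group 𝔾 using (Carrier; _≈_; _∙_; ε; _⁻¹; rawMonoid)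

  power : Carrier → ℤ → Carrier
  power x (+ k)    = RawMonoidDefinitions._×_ rawMonoid k x
  power x -[1+ k ] = (RawMonoidDefinitions._×_ rawMonoid (suc k) x) ⁻¹

  record Subgroup (p : Level) : Set (c ⊔ ℓ ⊔ lsuc p) where
    field
      Member    : Pred Carrier p
      resp      : ∀ {x y} → x ≈ y → Member x → Member y
      ε-closed  : Member ε
      ∙-closed  : ∀ {x y} → Member x → Member y → Member (x ∙ y)
      ⁻¹-closed : ∀ {x} → Member x → Member (x ⁻¹)

  data ⟨_⟩ {i} {I : Set i} (g : I → Carrier) : Pred Carrier (c ⊔ ℓ ⊔ i) where
    gen  : ∀ k → ⟨ g ⟩ (g k)
    unit : ⟨ g ⟩ ε
    mul  : ∀ {x y} → ⟨ g ⟩ x → ⟨ g ⟩ y → ⟨ g ⟩ (x ∙ y)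
    inv  : ∀ {x} → ⟨ g ⟩ x → ⟨ g ⟩ (x ⁻¹)
    resp : ∀ {x y} → x ≈ y → ⟨ g ⟩ x → ⟨ g ⟩ y

  GeneratedBy : ∀ {p i} {I : Set i} → Subgroup p → (I → Carrier) →
                Set (c ⊔ ℓ ⊔ p ⊔ i)
  GeneratedBy H g = Subgroup.Member H ≐ ⟨ g ⟩

-- The product σ ∙ τ applies τ first.
SymmetricGroup : ℕ → Group 0ℓ 0ℓ
SymmetricGroup n = record
  { Carrier = Permutation′ n
  ; _≈_     = Perm._≈_
  ; _∙_     = λ σ τ → τ ∘ₚ σ
  ; ε       = Perm.id
  ; _⁻¹     = flip
  ; isGroup = record
    { isMonoid = record
      { isSemigroup = record
        { isMagma = record
          { isEquivalence = record
            { refl  = λ _ → refl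
            ; sym   = λ σ≈τ i → sym (σ≈τ i)
            ; trans = λ σ≈τ τ≈υ i → trans (σ≈τ i) (τ≈υ i)
            }
          ; ∙-cong = λ {σ} {σ′} {τ} {τ′} σ≈σ′ τ≈τ′ i →
              trans (cong (σ ⟨$⟩ʳ_) (τ≈τ′ i)) (σ≈σ′ (τ′ ⟨$⟩ʳ i))
          }
        ; assoc = λ _ _ _ _ → refl
        }
      ; identity = (λ _ _ → refl) , (λ _ _ → refl)
      }
    ; inverse = (λ σ _ → inverseˡ σ) , (λ σ _ → inverseʳ σ)
    ; ⁻¹-cong = λ {σ} {τ} σ≈τ i → begin
        σ ⟨$⟩ˡ i                         ≡⟨ inverseˡ τ ⟨
        τ ⟨$⟩ˡ (τ ⟨$⟩ʳ (σ ⟨$⟩ˡ i))       ≡⟨ cong (τ ⟨$⟩ˡ_) (σ≈τ (σ ⟨$⟩ˡ i)) ⟨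
        τ ⟨$⟩ˡ (σ ⟨$⟩ʳ (σ ⟨$⟩ˡ i))       ≡⟨ cong (τ ⟨$⟩ˡ_) (inverseʳ σ) ⟩
        τ ⟨$⟩ˡ i                         ∎
    }
  }
  where open ≡-Reasoning

-- σ = (a a₂ … aₖ): the list a , a₂ , … , aₖ , a follows σ, and σ fixes every
-- other point.  A cycle of length one is the identity.
IsCycle : ∀ {n} → Permutation′ n → Set
IsCycle {n} σ = ∃₂ λ (a : Fin n) (as : List (Fin n)) →
  Unique (a ∷ as) ×
  Linked (λ x y → σ ⟨$⟩ʳ x ≡ y) ((a ∷ as) ∷ʳ a) ×
  (∀ x → ¬ (x ListMembership.∈ (a ∷ as)) → σ ⟨$⟩ʳ x ≡ x)

DisjointPermutations : ∀ {n} → Rel (Permutation′ n) 0ℓ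
DisjointPermutations σ τ = ∀ x → σ ⟨$⟩ʳ x ≡ x ⊎ τ ⟨$⟩ʳ x ≡ x

module _ {c ℓ₁ ℓ₂ : Level} (P : Poset c ℓ₁ ℓ₂) where
  open Poset P using (Carrier; _≈_; module Eq) renaming (_≤_ to _≤ₚ_)
  open PosetProperties P using (_<_)
  open SetoidMembership Eq.setoid using () renaming (_∈_ to _∈ₚ_)

  infix 4 _⋖_

  _⋖_ : Rel Carrier (c ⊔ ℓ₁ ⊔ ℓ₂)
  x ⋖ y = x < y × (∀ z → ¬ (x < z × z < y))

  IsSaturated : List⁺ Carrier → Set (c ⊔ ℓ₁ ⊔ ℓ₂)
  IsSaturated C = Linked _⋖_ (toList C)

  record Ranked : Set (c ⊔ ℓ₁ ⊔ ℓ₂) where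
    field
      elements     : List Carrier
      finite       : IsEnumeration Eq.setoid elements
      bottom       : Carrier
      minimum      : Minimum _≤ₚ_ bottom
      rank         : Carrier → ℕ
      -- length (tail C) is the number of elements of C minus one.
      chain-length : ∀ {x} (C : List⁺ Carrier) → IsSaturated C →
                     head C ≈ bottom → last C ≈ x → length (tail C) ≡ rank x

    totalRank : ℕ
    totalRank = max 0 (map rank elements)

    IsSymmetric : List⁺ Carrier → Set (c ⊔ ℓ₁ ⊔ ℓ₂)
    IsSymmetric C = IsSaturated C × rank (head C) + rank (last C) ≡ totalRank

  record SymmetricChainDecomposition (R : Ranked) : Set (c ⊔ ℓ₁ ⊔ ℓ₂) where
    field
      chains    : List (List⁺ Carrier)
      symmetric : All (Ranked.IsSymmetric R) chains
      covering  : ∀ x → Any (λ C → x ∈ₚ toList C) chains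
      disjoint  : AllPairs (λ C D → Disjoint Eq.setoid (toList C) (toList D)) chains

  SymmetricChainOrder : Set (c ⊔ ℓ₁ ⊔ ℓ₂)
  SymmetricChainOrder = Σ Ranked SymmetricChainDecomposition

-- y ∈ σ(A) iff σ⁻¹(y) ∈ A; see ∈-image.
image : ∀ {n} → Permutation′ n → Subset n → Subset n
image σ A = tabulate (λ y → lookup A (σ ⟨$⟩ˡ y))

∈-image : ∀ {n} (σ : Permutation′ n) (A : Subset n) {y : Fin n} →
          y ∈ image σ A ⇔ (∃ λ a → a ∈ A × σ ⟨$⟩ʳ a ≡ y)
∈-image {n} σ A {y} = mk⇔ to from
  where
  to : y ∈ image σ A → ∃ λ a → a ∈ A × σ ⟨$⟩ʳ a ≡ y
  to y∈ = σ ⟨$⟩ˡ y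
        , lookup⇒[]= _ A (trans (sym (lookup∘tabulate _ y)) ([]=⇒lookup y∈))
        , inverseʳ σ
  from : (∃ λ a → a ∈ A × σ ⟨$⟩ʳ a ≡ y) → y ∈ image σ A
  from (a , a∈A , refl) = lookup⇒[]= _ (image σ A)
    (trans (lookup∘tabulate _ (σ ⟨$⟩ʳ a))
      (trans (cong (lookup A) (inverseˡ σ)) ([]=⇒lookup a∈A)))

image-mono : ∀ {n} (σ : Permutation′ n) {A B : Subset n} →
             A ⊆ B → image σ A ⊆ image σ B
image-mono σ {A} {B} A⊆B y∈ with Equivalence.to (∈-image σ A) y∈
... | a , a∈A , eq = Equivalence.from (∈-image σ B) (a , A⊆B a∈A , eq)

image-id : ∀ {n} (A : Subset n) → image Perm.id A ≡ A
image-id []      = refl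
image-id (s ∷ A) = cong (s ∷_) (image-id A)

image-∘ : ∀ {n} (σ τ : Permutation′ n) (A : Subset n) →
          image σ (image τ A) ≡ image (τ ∘ₚ σ) A
image-∘ σ τ A = ⊆-antisym forth back
  where
  forth : image σ (image τ A) ⊆ image (τ ∘ₚ σ) A
  forth y∈ with Equivalence.to (∈-image σ (image τ A)) y∈
  ... | b , b∈ , refl with Equivalence.to (∈-image τ A) b∈
  ... | a , a∈ , refl =
    Equivalence.from (∈-image (τ ∘ₚ σ) A) (a , a∈ , refl)
  back : image (τ ∘ₚ σ) A ⊆ image σ (image τ A)
  back y∈ with Equivalence.to (∈-image (τ ∘ₚ σ) A) y∈
  ... | a , a∈ , refl = Equivalence.from (∈-image σ (image τ A))
    (τ ⟨$⟩ʳ a , Equivalence.from (∈-image τ A) (a , a∈ , refl) , refl)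

image-flip : ∀ {n} (σ : Permutation′ n) (A : Subset n) →
             image (flip σ) (image σ A) ≡ A
image-flip σ A = ⊆-antisym forth back
  where
  forth : image (flip σ) (image σ A) ⊆ A
  forth y∈ with Equivalence.to (∈-image (flip σ) (image σ A)) y∈
  ... | b , b∈ , refl with Equivalence.to (∈-image σ A) b∈
  ... | a , a∈ , refl = subst (_∈ A) (sym (inverseˡ σ)) a∈
  back : A ⊆ image (flip σ) (image σ A)
  back {a} a∈ = Equivalence.from (∈-image (flip σ) (image σ A))
    ( σ ⟨$⟩ʳ a
    , Equivalence.from (∈-image σ A) (a , a∈ , refl)
    , inverseˡ σ )

indicator : Side → ℕ
indicator s = if s then 1 else 0

∣∣-sum : ∀ {n} (A : Subset n) →
         ∣ A ∣ ≡ Sum.sum +-0-commutativeMonoid (λ i → indicator (lookup A i))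
∣∣-sum []            = refl
∣∣-sum (inside  ∷ A) = cong suc (∣∣-sum A)
∣∣-sum (outside ∷ A) = ∣∣-sum A

∣image∣ : ∀ {n} (σ : Permutation′ n) (A : Subset n) → ∣ image σ A ∣ ≡ ∣ A ∣
∣image∣ {n} σ A = begin
  ∣ image σ A ∣
    ≡⟨ ∣∣-sum (image σ A) ⟩
  sum (λ i → indicator (lookup (image σ A) i))
    ≡⟨ sum-cong-≗ {n} (λ i → cong indicator (lookup∘tabulate (λ y → lookup A (σ ⟨$⟩ˡ y)) i)) ⟩
  sum (λ i → indicator (lookup A (σ ⟨$⟩ˡ i)))
    ≡⟨ sum-permute (λ i → indicator (lookup A i)) (flip σ) ⟨
  sum (λ i → indicator (lookup A i))
    ≡⟨ ∣∣-sum A ⟨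
  ∣ A ∣ ∎
  where
  open ≡-Reasoning
  open Sum +-0-commutativeMonoid using (sum; sum-cong-≗; sum-permute)

⊆∧∣∣≥⇒≡ : ∀ {n} {A B : Subset n} → A ⊆ B → ∣ B ∣ ≤ ∣ A ∣ → A ≡ B
⊆∧∣∣≥⇒≡ {A = A} {B} A⊆B ∣B∣≤∣A∣ = ⊆-antisym A⊆B B⊆A
  where
  B⊆A : B ⊆ A
  B⊆A {x} x∈B with x ∈? A
  ... | yes x∈A = x∈A
  ... | no  x∉A =
    contradiction ∣B∣≤∣A∣ (<⇒≱ (p⊂q⇒∣p∣<∣q∣ (A⊆B , x , x∈B , x∉A)))

module _ {n : ℕ} {p : Level} (G : Subgroup (SymmetricGroup n) p) where
  open Subgroup G using (Member; ε-closed; ∙-closed; ⁻¹-closed)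

  infix 4 _∈[_] _≤ᴼ_

  record _∈[_] (B A : Subset n) : Set p where
    constructor moved-by
    field
      σ      : Permutation′ n
      σ∈G    : Member σ
      σ[A]≡B : image σ A ≡ B

  _≤ᴼ_ : Rel (Subset n) p
  A ≤ᴼ B = ∃₂ λ X Y → X ∈[ A ] × Y ∈[ B ] × X ⊆ Y

  orbit-refl : ∀ {A} → A ∈[ A ]
  orbit-refl {A} = moved-by Perm.id ε-closed (image-id A)

  orbit-sym : ∀ {A B} → B ∈[ A ] → A ∈[ B ]
  orbit-sym {A} (moved-by σ σ∈G refl) =
    moved-by (flip σ) (⁻¹-closed σ∈G) (image-flip σ A)

  orbit-trans : ∀ {A B C} → B ∈[ A ] → C ∈[ B ] → C ∈[ A ]
  orbit-trans {A} (moved-by σ σ∈G refl) (moved-by τ τ∈G refl) =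
    moved-by (σ ∘ₚ τ) (∙-closed τ∈G σ∈G) (sym (image-∘ τ σ A))

  orbit-∣∣ : ∀ {A B} → B ∈[ A ] → ∣ B ∣ ≡ ∣ A ∣
  orbit-∣∣ {A} (moved-by σ _ refl) = ∣image∣ σ A

  ≤ᴼ-trans : ∀ {A B C} → A ≤ᴼ B → B ≤ᴼ C → A ≤ᴼ C
  ≤ᴼ-trans (X , Y , X∈A , Y∈B , X⊆Y) (Y′ , Z , Y′∈B , Z∈C , Y′⊆Z)
    with orbit-trans (orbit-sym Y∈B) Y′∈B
  ... | moved-by σ σ∈G refl =
    image σ X , Z , orbit-trans X∈A (moved-by σ σ∈G refl) , Z∈C ,
    λ x∈ → Y′⊆Z (image-mono σ X⊆Y x∈)

  ≤ᴼ-∣∣ : ∀ {A B} → A ≤ᴼ B → ∣ A ∣ ≤ ∣ B ∣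
  ≤ᴼ-∣∣ (X , Y , X∈A , Y∈B , X⊆Y) =
    ≤-trans (≤-reflexive (sym (orbit-∣∣ X∈A)))
      (≤-trans (p⊆q⇒∣p∣≤∣q∣ X⊆Y) (≤-reflexive (orbit-∣∣ Y∈B)))

  ≤ᴼ-antisym : ∀ {A B} → A ≤ᴼ B → B ≤ᴼ A → B ∈[ A ]
  ≤ᴼ-antisym (X , Y , X∈A , Y∈B , X⊆Y) B≤A
    with ⊆∧∣∣≥⇒≡ X⊆Y (≤-trans (≤-reflexive (orbit-∣∣ Y∈B))
           (≤-trans (≤ᴼ-∣∣ B≤A) (≤-reflexive (sym (orbit-∣∣ X∈A)))))
  ... | refl = orbit-trans X∈A (orbit-sym Y∈B)

  -- An orbit [A] is represented by any of its members, and two subsets are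
  -- equal in the quotient when they lie in the same orbit.
  BooleanQuotient : Poset 0ℓ p p
  BooleanQuotient = record
    { Carrier        = Subset n
    ; _≈_            = λ A B → B ∈[ A ]
    ; _≤_            = _≤ᴼ_
    ; isPartialOrder = record
      { isPreorder = record
        { isEquivalence = record
          { refl  = orbit-refl
          ; sym   = orbit-sym
          ; trans = orbit-trans
          }
        ; reflexive = λ {A} {B} B∈A → B , B , B∈A , orbit-refl , λ x∈ → x∈
        ; trans     = ≤ᴼ-trans
        }
      ; antisym = ≤ᴼ-antisym
      }
    }

{-# OPTIONS --safe #-}

-- Read a subset of a k-cycle as a cyclic 0-1 word and match brackets cyclically, 1 opening
-- and 0 closing.  The unmatched positions all carry the same letter; forgetting it leaves
-- a core c, whose two fillings lo c ⊆ hi c have complementary sizes, and every word is lo c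
-- or hi c for a unique c.  Let next c match the two unmatched positions that bound a longest
-- arc without unmatched positions.  Then lo c ⋖ lo (next c) and hi (next c) ⋖ hi c, so the
-- chains lo c , lo (next c) , … , hi (next c) , hi c are symmetric.  They are disjoint
-- because next is injective, even up to rotation: if next c = next d arises from different
-- arcs, then the arc of c, ends included, is free of unmatched positions in d and so is
-- shorter than the arc of d, and vice versa.  Hence the quotient by any group of rotations
-- of one cycle has a symmetric chain decomposition.  For several disjoint cycles the
-- quotient is a product, and a product of two chains splits into symmetric hooks.

module Submission where

open import Data.Fin.Base using (Fin)
open import Data.Fin.Permutation using (Permutation′)
open import Data.Integer.Base using (ℤ)
open import Data.Nat.Base using (ℕ; _≤_)
open import Level using (Level)
open import Relation.Binary.PropositionalEquality using (_≢_)
open import Defs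

open import Algebra.Bundles using (Group)
open import Algebra.Definitions.RawMonoid using () renaming (_×_ to times)
open import Data.Bool.Base using (Bool; true; false; not; if_then_else_) renaming (_≤_ to _≤ᴮ_)
open import Data.Bool.Properties as Boolₚ using (¬-not) renaming (_≟_ to _≟ᵇ_)
open import Data.Empty using (⊥-elim)
open import Data.Fin.Base using (zero; suc; toℕ; fromℕ<)
open import Data.Fin.Permutation as Perm
  using (_⟨$⟩ʳ_; _⟨$⟩ˡ_; _∘ₚ_; inverseˡ; inverseʳ)
open import Data.Fin.Properties using (all?; any?; toℕ-fromℕ<; ¬∀⟶∃¬) renaming (_≟_ to _≟ᶠ_)
open import Data.Fin.Subset using (Subset; inside; outside; ∣_∣; ⊤; ⊥; _⊆_)
open import Data.Fin.Subset.Properties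
  using (∣⊤∣≡n; ∣⊥∣≡0; ∣p∣≤n; ⊥⊆; drop-∷-⊆; s⊆s; out⊆; ⊆-refl)
open import Data.Integer.Base using (-[1+_]) renaming (+_ to pos)
open import Data.List.Base
  using (List; []; _∷_; [_]; _++_; _∷ʳ_; map; concat; concatMap; filter; allFin; applyUpTo;
         length; lookup; deduplicate; cartesianProduct; initLast; _∷ʳ′_)
  renaming (tabulate to tabulateˡ)
open import Data.List.Extrema.Nat using (max≤v⁺; v≤max⁺)
open import Data.List.Membership.DecPropositional using (_∈?_)
open import Data.List.Membership.Propositional using (_∈_; lose; find)
open import Data.List.Membership.Propositional.Properties
  using (∈-++⁺ˡ; ∈-++⁺ʳ; ∈-map⁺; ∈-allFin; ∈-filter⁺; ∈-lookup; ∈-concat⁺′; ∈-concatMap⁺;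
         ∈-applyUpTo⁺; ∈-applyUpTo⁻)
open import Data.List.Membership.Propositional.Properties.WithK using (unique∧set⇒bag)
import Data.List.Membership.Setoid as SetoidMembership
import Data.List.Membership.Setoid.Properties as SetoidMembershipₚ
open import Data.List.NonEmpty.Base as List⁺ using (toList; last) renaming (_∷_ to _∷⁺_)
open import Data.List.Properties
  using (concat-++; concat-map; map-++; ++-assoc; ++-identityʳ; concatMap-++;
         cartesianProductWith-zeroʳ; cartesianProductWith-distribʳ-++; map-applyUpTo; map-tabulate)
open import Data.List.Relation.Binary.BagAndSetEquality using (∼bag⇒↭)
open import Data.List.Relation.Binary.Disjoint.Setoid using (Disjoint)
open import Data.List.Relation.Binary.Permutation.Propositional as Permutation
  using (_↭_; prep; ↭-refl; ↭-sym; ↭-trans; ↭-reflexive; ↭⇒↭ₛ; module PermutationReasoning)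
open import Data.List.Relation.Binary.Permutation.Propositional.Properties
  using (Any-resp-↭; ++⁺; ++⁺ˡ; shifts; ∷↭∷ʳ) renaming (map⁺ to ↭-map⁺)
import Data.List.Relation.Binary.Permutation.Setoid.Properties as SetoidPermutationₚ
open import Data.List.Relation.Unary.All as All using (All; []; _∷_)
import Data.List.Relation.Unary.All.Properties as Allₚ
open import Data.List.Relation.Unary.AllPairs as AllPairs using (AllPairs; []; _∷_)
import Data.List.Relation.Unary.AllPairs.Properties as AllPairsₚ
open import Data.List.Relation.Unary.Any as Any using (Any; here; there)
import Data.List.Relation.Unary.Any.Properties as Anyₚ
import Data.List.Relation.Unary.Enumerates.Setoid.Properties as Enumeratesₚ
open import Data.List.Relation.Unary.Linked using (Linked; [-]; _∷_)
import Data.List.Relation.Unary.Unique.DecSetoid.Properties as DecUniqueₚ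
open import Data.List.Relation.Unary.Unique.Propositional using (Unique)
import Data.List.Relation.Unary.Unique.Propositional.Properties as Uniqueₚ
import Data.List.Relation.Unary.Unique.Setoid as SetoidUnique
import Data.List.Relation.Unary.Unique.Setoid.Properties as SetoidUniqueₚ
open import Data.Nat.Base hiding (_≤ᵇ_)
open import Data.Nat.DivMod
open import Data.Nat.ListAction using (sum)
open import Data.Nat.ListAction.Properties using (sum-↭; sum-++)
open import Data.Nat.Properties
open import Data.Nat.Tactic.RingSolver using (solve-∀)
open import Data.Product.Base using (Σ; ∃; ∃₂; _×_; _,_; proj₁; proj₂)
open import Data.Product.Relation.Binary.Pointwise.NonDependent using (×-preorder)
open import Data.Sum.Base using (_⊎_; inj₁; inj₂)
open import Data.Vec.Base as Vec using ([]; _∷_; tabulate) renaming (lookup to lookupᵛ)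
open import Data.Vec.Properties
  using (lookup∘tabulate; lookup-replicate; tabulate∘lookup; tabulate-cong; lookup⇒[]=; []=⇒lookup)
open import Function.Base using (_∘_; id)
open import Function.Bundles using (mk⇔)
open import Level using (0ℓ)
open import Relation.Binary.Bundles using (DecSetoid; Poset; Preorder; Setoid)
open import Relation.Binary.Definitions using (Tri; tri<; tri≈; tri>)
open import Relation.Binary.PropositionalEquality
  using (_≡_; refl; sym; trans; cong; cong₂; subst; subst₂; resp₂; setoid; module ≡-Reasoning)
open import Relation.Nullary using (¬_; Dec; yes; no; does; contradiction)
open import Relation.Nullary.Decidable using (map′; _×-dec_; ¬?)

-- Cyclic words and their cores

-- When several arcs are longest, `next` picks one of them by its place on the circle, so it need
-- not commute with rotations and is not set up as a map of orbits. It is applied to one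
-- representative core per class. Injectivity that tolerates a rotation between the two results is
-- then enough, because an injective partial map splits its domain into paths. The arc has to be a
-- long one for this: with short arcs `_ _ ( )` and `( ) _ _` both lead to `( ) ( )`. A core is
-- stored as a periodic bracket depth, not as a list of matched pairs. A circle has no first bracket
-- from which to start matching. With depths, uniqueness of the core becomes the fact that a
-- monotone periodic function is constant, and the arc of a match can be located by the zeros of the
-- depth. The quotient by several cycles is a product because each generator moves the points of one
-- cycle only, so that the exponents can be chosen independently. Points fixed by all cycles take
-- part as cycles of length one.

∑ : (ℕ → ℕ) → ℕ → ℕ
∑ f m = sum (applyUpTo f m)

∑-suc : ∀ f m → ∑ f (suc m) ≡ ∑ f m + f m
∑-suc f zero    = +-comm (f 0) 0
∑-suc f (suc m) = trans (cong (f 0 +_) (∑-suc (f ∘ suc) m)) (sym (+-assoc (f 0) _ _))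

∑-cong : ∀ {f g} m → (∀ {i} → i < m → f i ≡ g i) → ∑ f m ≡ ∑ g m
∑-cong zero    f≗g = refl
∑-cong (suc m) f≗g = cong₂ _+_ (f≗g z<s) (∑-cong m (f≗g ∘ s<s))

∑-mono : ∀ {f g} m → (∀ {i} → i < m → f i ≤ g i) → ∑ f m ≤ ∑ g m
∑-mono zero    f≤g = z≤n
∑-mono (suc m) f≤g = +-mono-≤ (f≤g z<s) (∑-mono m (f≤g ∘ s<s))

module Cyclic (k′ : ℕ) where

  k : ℕ
  k = suc k′

  private variable
    A : Set
    i j : ℕ

  infix 4 _≋_ _≋?_

  record _≋_ (i j : ℕ) : Set where
    constructor residues
    field residue : i % k ≡ j % k

  open _≋_

  _≋?_ : ∀ i j → Dec (i ≋ j)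
  i ≋? j = map′ residues residue (i % k ≟ j % k)

  ≡⇒≋ : i ≡ j → i ≋ j
  ≡⇒≋ refl = residues refl

  ≋-sym : i ≋ j → j ≋ i
  ≋-sym (residues eq) = residues (sym eq)

  ≋-trans : ∀ {l} → i ≋ j → j ≋ l → i ≋ l
  ≋-trans (residues eq) (residues eq′) = residues (trans eq eq′)

  Periodic : (ℕ → A) → Set
  Periodic f = ∀ j → f (j + k) ≡ f j

  +k-≋ : ∀ j → j + k ≋ j
  +k-≋ j = residues ([m+n]%n≡m%n j k)

  +*k-≋ : ∀ j s → j + s * k ≋ j
  +*k-≋ j s = residues ([m+kn]%n≡m%n j s k)

  %-≋ : ∀ j → j % k ≋ j
  %-≋ j = residues (m%n%n≡m%n j k)

  ≋-+ : ∀ s → i ≋ j → i + s ≋ j + s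
  ≋-+ {i} {j} s (residues i≋j) = residues (begin
    (i + s) % k          ≡⟨ %-distribˡ-+ i s k ⟩
    (i % k + s % k) % k  ≡⟨ cong (λ x → (x + s % k) % k) i≋j ⟩
    (j % k + s % k) % k  ≡⟨ %-distribˡ-+ j s k ⟨
    (j + s) % k          ∎)
    where open ≡-Reasoning

  -- Since k is k′ + 1, the number s * k′ is -s modulo k. Adding it replaces subtraction throughout,
  -- so that positions remain natural numbers.
  +s+sk′ : ∀ j s → j + s + s * k′ ≡ j + s * k
  +s+sk′ j s = trans (+-assoc j s _) (cong (j +_) (sym (*-suc s k′)))

  +sk′+s : ∀ j s → j + s * k′ + s ≡ j + s * k
  +sk′+s j s = trans (+-assoc j _ s)
    (cong (j +_) (trans (+-comm _ s) (sym (*-suc s k′))))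

  +s+sk′-≋ : ∀ j s → j + s + s * k′ ≋ j
  +s+sk′-≋ j s = ≋-trans (≡⇒≋ (+s+sk′ j s)) (+*k-≋ j s)

  +sk′+s-≋ : ∀ j s → j + s * k′ + s ≋ j
  +sk′+s-≋ j s = ≋-trans (≡⇒≋ (+sk′+s j s)) (+*k-≋ j s)

  ≋-cancel : ∀ s → i + s ≋ j + s → i ≋ j
  ≋-cancel s eq = ≋-trans (≋-sym (+s+sk′-≋ _ s))
    (≋-trans (≋-+ (s * k′) eq) (+s+sk′-≋ _ s))

  small≋ : i < k → j < k → i ≋ j → i ≡ j
  small≋ i<k j<k (residues eq) =
    trans (sym (m<n⇒m%n≡m i<k)) (trans eq (m<n⇒m%n≡m j<k))

  -- The witness is the residue of j − u.
  offset : ∀ u j → ∃ λ i → i < k × i + u ≋ j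
  offset u j = (j + u * k′) % k , m%n<n (j + u * k′) k ,
    ≋-trans (≋-+ u (%-≋ (j + u * k′))) (+sk′+s-≋ j u)

  module _ {f : ℕ → A} (f-per : Periodic f) where

    periodic-* : ∀ j s → f (j + s * k) ≡ f j
    periodic-* j zero    = cong f (+-identityʳ j)
    periodic-* j (suc s) = trans
      (cong f (trans (cong (j +_) (+-comm k (s * k))) (sym (+-assoc j _ k))))
      (trans (f-per (j + s * k)) (periodic-* j s))

    periodic-% : ∀ j → f j ≡ f (j % k)
    periodic-% j = trans (cong f (m≡m%n+[m/n]*n j k)) (periodic-* (j % k) (j / k))

    periodic-≋ : i ≋ j → f i ≡ f j
    periodic-≋ {i} {j} eq =
      trans (periodic-% i) (trans (cong f (residue eq)) (sym (periodic-% j)))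

    periodic-shift : ∀ s → Periodic (λ j → f (j + s))
    periodic-shift s j = trans
      (cong f (trans (+-assoc j k s) (trans (cong (j +_) (+-comm k s)) (sym (+-assoc j s k)))))
      (f-per (j + s))

  periodic-∘ : ∀ {B : Set} (g : A → B) {f : ℕ → A} → Periodic f → Periodic (g ∘ f)
  periodic-∘ g per j = cong g (per j)

  ∑-shift : ∀ {f : ℕ → ℕ} → Periodic f → ∀ s → ∑ (λ j → f (j + s)) k ≡ ∑ f k
  ∑-shift {f} per zero    = ∑-cong k (λ {i} _ → cong f (+-identityʳ i))
  ∑-shift {f} per (suc s) = +-cancelˡ-≡ (f s) _ _ (begin
    f s + ∑ (λ j → f (j + suc s)) k   ≡⟨ cong (f s +_) (∑-cong k (λ {i} _ → cong f (+-suc i s))) ⟩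
    ∑ (λ j → f (j + s)) (suc k)       ≡⟨ ∑-suc (λ j → f (j + s)) k ⟩
    ∑ (λ j → f (j + s)) k + f (k + s) ≡⟨ cong₂ _+_ (∑-shift per s) (trans (cong f (+-comm k s)) (per s)) ⟩
    ∑ f k + f s                       ≡⟨ +-comm (∑ f k) (f s) ⟩
    f s + ∑ f k                       ∎)
    where open ≡-Reasoning

  -- A sum over a whole turn may start anywhere. Started at `v`, the changed term stands first and
  -- the remaining k′ terms agree.
  ∑-bump : ∀ {f g : ℕ → ℕ} → Periodic f → Periodic g → ∀ v →
           g v ≡ suc (f v) → (∀ j → ¬ j ≋ v → g j ≡ f j) → ∑ g k ≡ suc (∑ f k)
  ∑-bump {f} {g} f-per g-per v at elsewhere = begin
    ∑ g k                                 ≡⟨ ∑-shift g-per v ⟨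
    g v + ∑ (λ j → g (suc j + v)) k′      ≡⟨ cong₂ _+_ at (∑-cong k′ away) ⟩
    suc (f v + ∑ (λ j → f (suc j + v)) k′) ≡⟨ cong suc (∑-shift f-per v) ⟩
    suc (∑ f k)                           ∎
    where
    open ≡-Reasoning
    away : ∀ {i} → i < k′ → g (suc i + v) ≡ f (suc i + v)
    away {i} i<k′ = elsewhere _ λ eq →
      0≢1+n (sym (small≋ (s<s i<k′) z<s (≋-cancel v eq)))

  -- A whole turn leads back to the same value, which leaves no room for a strict descent on the
  -- way. Uniqueness of cores rests on this and on its mirror image below.
  antitone⇒constant : ∀ {f : ℕ → ℕ} → Periodic f → (∀ j → f (suc j) ≤ f j) →
                      ∀ j → f (suc j) ≡ f j
  antitone⇒constant {f} per dec j = ≤-antisym (dec j) (begin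
    f j             ≡⟨ per j ⟨
    f (j + k)       ≡⟨ cong f (+-suc j k′) ⟩
    f (suc j + k′)  ≤⟨ descend k′ ⟩
    f (suc j)       ∎)
    where
    open ≤-Reasoning
    descend : ∀ i → f (suc j + i) ≤ f (suc j)
    descend zero    = ≤-reflexive (cong f (+-identityʳ (suc j)))
    descend (suc i) = ≤-trans (≤-reflexive (cong f (+-suc (suc j) i)))
      (≤-trans (dec (suc j + i)) (descend i))

  monotone⇒constant : ∀ {f : ℕ → ℕ} → Periodic f → (∀ j → f j ≤ f (suc j)) →
                      ∀ j → f (suc j) ≡ f j
  monotone⇒constant {f} per inc j = ≤-antisym (begin
    f (suc j)       ≤⟨ ascend k′ ⟩
    f (suc j + k′)  ≡⟨ cong f (+-suc j k′) ⟨
    f (j + k)       ≡⟨ per j ⟩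
    f j             ∎) (inc j)
    where
    open ≤-Reasoning
    ascend : ∀ i → f (suc j) ≤ f (suc j + i)
    ascend zero    = ≤-reflexive (cong f (sym (+-identityʳ (suc j))))
    ascend (suc i) = ≤-trans (ascend i)
      (≤-trans (inc (suc j + i)) (≤-reflexive (cong f (sym (+-suc (suc j) i)))))

  -- Cores and their uniqueness

  data Letter : Set where
    up down flat : Letter

  flat? : (l : Letter) → Dec (l ≡ flat)
  flat? up   = no λ ()
  flat? down = no λ ()
  flat? flat = yes refl

  fill : Bool → Letter → Bool
  fill b up   = true
  fill b down = false
  fill b flat = b

  -- The clause for `flat` keeps unmatched positions outside all brackets. With heights in ℕ and
  -- periodicity, these local conditions describe a cyclic matching without naming partners.
  Follows : Letter → ℕ → ℕ → Set
  Follows up   a b = b ≡ suc a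
  Follows down a b = a ≡ suc b
  Follows flat a b = a ≡ 0 × b ≡ 0

  -- A cyclic bracket word: up opens, down closes, flat is unmatched, and height is
  -- the bracket depth.
  record Core : Set where
    field
      letter     : ℕ → Letter
      height     : ℕ → ℕ
      letter-per : Periodic letter
      height-per : Periodic height
      follows    : ∀ j → Follows (letter j) (height j) (height (suc j))

  open Core

  shift : ℕ → Core → Core
  shift s C = record
    { letter     = λ j → letter C (j + s)
    ; height     = λ j → height C (j + s)
    ; letter-per = periodic-shift (letter-per C) s
    ; height-per = periodic-shift (height-per C) s
    ; follows    = λ j → follows C (j + s)
    }

  flat⇒0 : ∀ C → letter C j ≡ flat → height C j ≡ 0
  flat⇒0 {j} C eq with letter C j | follows C j
  flat⇒0 C refl | flat | p = proj₁ p

  flat⇒suc0 : ∀ C → letter C j ≡ flat → height C (suc j) ≡ 0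
  flat⇒suc0 {j} C eq with letter C j | follows C j
  flat⇒suc0 C refl | flat | p = proj₂ p

  fill-false-gap : ∀ l l′ {a b a′ b′} → Follows l a b → Follows l′ a′ b′ →
    fill false l ≡ fill false l′ →
    (l ≡ l′ × ∣ b - b′ ∣ ≡ ∣ a - a′ ∣) ⊎ ∣ a - a′ ∣ ≡ suc ∣ b - b′ ∣
  fill-false-gap up   up   refl refl _ = inj₁ (refl , refl)
  fill-false-gap down down refl refl _ = inj₁ (refl , refl)
  fill-false-gap flat flat (refl , refl) (refl , refl) _ = inj₁ (refl , refl)
  fill-false-gap flat down (refl , refl) refl _ = inj₂ refl
  fill-false-gap down flat refl (refl , refl) _ = inj₂ (cong suc (sym (∣-∣-identityʳ _)))

  fill-true-gap : ∀ l l′ {a b a′ b′} → Follows l a b → Follows l′ a′ b′ →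
    fill true l ≡ fill true l′ →
    (l ≡ l′ × ∣ b - b′ ∣ ≡ ∣ a - a′ ∣) ⊎ ∣ b - b′ ∣ ≡ suc ∣ a - a′ ∣
  fill-true-gap up   up   refl refl _ = inj₁ (refl , refl)
  fill-true-gap down down refl refl _ = inj₁ (refl , refl)
  fill-true-gap flat flat (refl , refl) (refl , refl) _ = inj₁ (refl , refl)
  fill-true-gap flat up (refl , refl) refl _ = inj₂ refl
  fill-true-gap up flat refl (refl , refl) _ = inj₂ (cong suc (sym (∣-∣-identityʳ _)))

  -- Each filling confuses `flat` with one bracket only: `down` for `false`, `up` for `true`. At
  -- such a place the flat side stays at height 0 while the other side descends, respectively
  -- ascends, by one. So the distance of the heights changes in one direction only along the circle;
  -- being periodic it is constant, and no confusion occurs.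
  fill-injective : ∀ b C D → (∀ j → fill b (letter C j) ≡ fill b (letter D j)) →
                   ∀ j → letter C j ≡ letter D j
  fill-injective b C D eq = go b eq
    where
    gap : ℕ → ℕ
    gap j = ∣ height C j - height D j ∣
    gap-per : Periodic gap
    gap-per j = cong₂ ∣_-_∣ (height-per C j) (height-per D j)
    go : ∀ b → (∀ j → fill b (letter C j) ≡ fill b (letter D j)) →
         ∀ j → letter C j ≡ letter D j
    go false eq j with fill-false-gap _ _ (follows C j) (follows D j) (eq j)
    ... | inj₁ (l≡l′ , _) = l≡l′
    ... | inj₂ drop = contradiction
      (trans (sym drop) (sym (antitone⇒constant gap-per decreasing j))) 1+n≢n
      where
      decreasing : ∀ j → gap (suc j) ≤ gap j
      decreasing j with fill-false-gap _ _ (follows C j) (follows D j) (eq j)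
      ... | inj₁ (_ , same) = ≤-reflexive same
      ... | inj₂ drop = ≤-trans (n≤1+n _) (≤-reflexive (sym drop))
    go true eq j with fill-true-gap _ _ (follows C j) (follows D j) (eq j)
    ... | inj₁ (l≡l′ , _) = l≡l′
    ... | inj₂ rise = contradiction
      (trans (sym rise) (monotone⇒constant gap-per increasing j)) 1+n≢n
      where
      increasing : ∀ j → gap j ≤ gap (suc j)
      increasing j with fill-true-gap _ _ (follows C j) (follows D j) (eq j)
      ... | inj₁ (_ , same) = ≤-reflexive (sym same)
      ... | inj₂ rise = ≤-trans (n≤1+n _) (≤-reflexive (sym rise))

  -- Matching two unmatched positions

  raise-follows : ∀ l {a b} → l ≢ flat → Follows l a b → Follows l (suc a) (suc b)
  raise-follows up   _   p = cong suc p
  raise-follows down _   p = cong suc p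
  raise-follows flat l≢  _ = contradiction refl l≢

  -- `g + u` is not reduced modulo k, so an arc may run past the end of the word. The last three
  -- fields fix the heights of `E` on the arc and just behind it; they are what distinguishes one
  -- arc from another in the injectivity proof.
  record Match (C E : Core) : Set where
    field
      u g       : ℕ
      0<g       : 0 < g
      g<k       : g < k
      flat-u    : letter C u ≡ flat
      flat-g+u  : letter C (g + u) ≡ flat
      interior    : ∀ i → 0 < i → i < g → letter C (i + u) ≢ flat
      up-u      : letter E u ≡ up
      down-g+u  : letter E (g + u) ≡ down
      elsewhere : ∀ j → ¬ j ≋ u → ¬ j ≋ g + u → letter E j ≡ letter C j
      base      : height E u ≡ 0
      positive  : ∀ i → 0 < i → i ≤ g → 0 < height E (i + u)
      return    : height E (suc g + u) ≡ 0

  -- The arc is first assumed to start at 0, where lying on it is a comparison of residues with `g`.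
  -- A shift reduces `match` to this case.
  module Join (D : Core) (g : ℕ) (0<g : 0 < g) (g<k : g < k)
              (flat-0 : letter D 0 ≡ flat) (flat-g : letter D g ≡ flat)
              (interior : ∀ i → 0 < i → i < g → letter D i ≢ flat) where

    letterAt : ℕ → Letter → Letter
    letterAt i l with i ≟ 0 | i ≟ g
    ... | yes _ | _     = up
    ... | no _  | yes _ = down
    ... | no _  | no _  = l

    letterAt-g : ∀ l → letterAt g l ≡ down
    letterAt-g l with g ≟ 0 | g ≟ g
    ... | yes g≡0 | _      = contradiction g≡0 (>⇒≢ 0<g)
    ... | no _    | yes _  = refl
    ... | no _    | no g≢g = contradiction refl g≢g

    letterAt-else : ∀ {i} l → i ≢ 0 → i ≢ g → letterAt i l ≡ l
    letterAt-else {i} l i≢0 i≢g with i ≟ 0 | i ≟ g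
    ... | yes i≡0 | _       = contradiction i≡0 i≢0
    ... | no _    | yes i≡g = contradiction i≡g i≢g
    ... | no _    | no _    = refl

    -- The height at a position is the depth before its letter. A bracket opened at 0 and closed at
    -- `g` therefore deepens positions 1 to `g`, the closing one included.
    bump : ℕ → ℕ
    bump i with 0 <? i | i ≤? g
    ... | yes _ | yes _ = 1
    ... | _     | _     = 0

    bump-in : ∀ {i} → 0 < i → i ≤ g → bump i ≡ 1
    bump-in {i} 0<i i≤g with 0 <? i | i ≤? g
    ... | yes _ | yes _   = refl
    ... | yes _ | no i≰g  = contradiction i≤g i≰g
    ... | no 0≮i | _      = contradiction 0<i 0≮i

    bump-out : ∀ {i} → g < i → bump i ≡ 0
    bump-out {i} g<i with 0 <? i | i ≤? g
    ... | yes _ | yes i≤g = contradiction i≤g (<⇒≱ g<i)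
    ... | yes _ | no _    = refl
    ... | no _  | _       = refl

    suc-% : ∀ j → suc j % k ≡ suc (j % k) % k
    suc-% j = residue (≋-trans (≡⇒≋ (+-comm 1 j))
      (≋-trans (≋-+ 1 (≋-sym (%-≋ j))) (≡⇒≋ (+-comm (j % k) 1))))

    bump-next-in : ∀ j → j % k < g → bump (suc j % k) ≡ 1
    bump-next-in j i<g = trans
      (cong bump (trans (suc-% j) (m<n⇒m%n≡m (≤-trans (s≤s i<g) g<k))))
      (bump-in z<s i<g)

    bump-next-out : ∀ j → g ≤ j % k → bump (suc j % k) ≡ 0
    bump-next-out j g≤i with m≤n⇒m<n∨m≡n (m%n<n j k)
    ... | inj₁ 1+i<k = trans (cong bump (trans (suc-% j) (m<n⇒m%n≡m 1+i<k)))
      (bump-out (s≤s g≤i))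
    -- The next position wraps round to 0, where `bump` is 0: the new bracket opens only after that
    -- height is read.
    ... | inj₂ 1+i≡k = cong bump
      (trans (suc-% j) (trans (cong (_% k) 1+i≡k) (n%n≡0 k)))

    letter₀ : ℕ → Letter
    letter₀ j = letterAt (j % k) (letter D j)

    height₀ : ℕ → ℕ
    height₀ j = bump (j % k) + height D j

    letter-% : ∀ j → letter D j ≡ letter D (j % k)
    letter-% = periodic-% (letter-per D)

    retarget : ∀ {j l x y} → letter₀ j ≡ l → bump (j % k) ≡ x → bump (suc j % k) ≡ y →
               Follows l (x + height D j) (y + height D (suc j)) →
               Follows (letter₀ j) (height₀ j) (height₀ (suc j))
    retarget refl refl refl p = p

    ground : ∀ {j i} → j % k ≡ i → letter D i ≡ flat →
             height D j ≡ 0 × height D (suc j) ≡ 0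
    ground {j} {i} eq flat-i = flat⇒0 D flat-j , flat⇒suc0 D flat-j
      where
      flat-j : letter D j ≡ flat
      flat-j = trans (letter-% j) (trans (cong (letter D) eq) flat-i)

    follows₀ : ∀ j → Follows (letter₀ j) (height₀ j) (height₀ (suc j))
    follows₀ j = by-position (<-cmp (j % k) g) (j % k ≟ 0)
      where
      by-position : Tri (j % k < g) (j % k ≡ g) (g < j % k) → Dec (j % k ≡ 0) →
                    Follows (letter₀ j) (height₀ j) (height₀ (suc j))
      by-position (tri< i<g _ _) (yes i≡0) = retarget
        (cong (λ i → letterAt i (letter D j)) i≡0) (cong bump i≡0) (bump-next-in j i<g)
        (let a≡0 , b≡0 = ground i≡0 flat-0
         in cong suc (trans b≡0 (sym a≡0)))
      by-position (tri< i<g i≢g _) (no i≢0) = retarget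
        (letterAt-else _ i≢0 i≢g) (bump-in (n≢0⇒n>0 i≢0) (<⇒≤ i<g)) (bump-next-in j i<g)
        (raise-follows _
          (λ eq → interior _ (n≢0⇒n>0 i≢0) i<g (trans (sym (letter-% j)) eq))
          (follows D j))
      by-position (tri≈ _ i≡g _) _ = retarget
        (trans (cong (λ i → letterAt i (letter D j)) i≡g) (letterAt-g _))
        (trans (cong bump i≡g) (bump-in 0<g ≤-refl))
        (bump-next-out j (≤-reflexive (sym i≡g)))
        (let a≡0 , b≡0 = ground i≡g flat-g
         in cong suc (trans a≡0 (sym b≡0)))
      by-position (tri> _ i≢g g<i) _ = retarget
        (letterAt-else _ (>⇒≢ (≤-trans z<s g<i)) i≢g) (bump-out g<i)
        (bump-next-out j (<⇒≤ g<i)) (follows D j)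

    joined : Core
    joined = record
      { letter     = letter₀
      ; height     = height₀
      ; letter-per = λ j → cong₂ letterAt (residue (+k-≋ j)) (letter-per D j)
      ; height-per = λ j → cong₂ (λ i x → bump i + x) (residue (+k-≋ j)) (height-per D j)
      ; follows    = follows₀
      }

  match : ∀ C u g → 0 < g → g < k → letter C u ≡ flat → letter C (g + u) ≡ flat →
          (∀ i → 0 < i → i < g → letter C (i + u) ≢ flat) →
          ∃₂ λ E (M : Match C E) → Match.u M ≡ u × Match.g M ≡ g
  match C u g 0<g g<k flat-u flat-g+u interior = E , record
    { u = u ; g = g ; 0<g = 0<g ; g<k = g<k
    ; flat-u = flat-u ; flat-g+u = flat-g+u ; interior = interior
    ; up-u = E-letter 0
    ; down-g+u = trans (E-letter g)
        (trans (cong (λ i → letterAt i (letter C (g + u))) (m<n⇒m%n≡m g<k)) (letterAt-g _))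
    ; elsewhere = elsewhere
    ; base = trans (E-height 0) (flat⇒0 C flat-u)
    ; positive = λ i 0<i i≤g → subst (0 <_)
        (sym (trans (E-height i) (cong (_+ height C (i + u))
          (trans (cong bump (m<n⇒m%n≡m (≤-<-trans i≤g g<k))) (bump-in 0<i i≤g)))))
        z<s
    ; return = trans (E-height (suc g))
        (cong₂ _+_ (bump-next-out g (≤-reflexive (sym (m<n⇒m%n≡m g<k))))
          (flat⇒suc0 C flat-g+u))
    } , refl , refl
    where
    open Join (shift u C) g 0<g g<k flat-u flat-g+u interior
    -- The arc was brought to 0 by `shift u`; the shift by `u * k′`, which is -u modulo k, puts it
    -- back.
    E : Core
    E = shift (u * k′) joined
    E-letter : ∀ i → letter E (i + u) ≡ letter₀ i
    E-letter i = periodic-≋ (letter-per joined) (+s+sk′-≋ i u)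
    E-height : ∀ i → height E (i + u) ≡ height₀ i
    E-height i = periodic-≋ (height-per joined) (+s+sk′-≋ i u)
    elsewhere : ∀ j → ¬ j ≋ u → ¬ j ≋ g + u → letter E j ≡ letter C j
    elsewhere j j≋̸u j≋̸g+u with offset u j
    ... | i , i<k , i+u≋j = begin
      letter E j                      ≡⟨ periodic-≋ (letter-per E) i+u≋j ⟨
      letter E (i + u)                ≡⟨ E-letter i ⟩
      letterAt (i % k) (letter C (i + u)) ≡⟨ letterAt-else _ i%k≢0 i%k≢g ⟩
      letter C (i + u)                ≡⟨ periodic-≋ (letter-per C) i+u≋j ⟩
      letter C j                      ∎
      where
      open ≡-Reasoning
      i%k≢0 : i % k ≢ 0
      i%k≢0 eq = j≋̸u (≋-trans (≋-sym i+u≋j) (≋-+ u (residues eq)))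
      i%k≢g : i % k ≢ g
      i%k≢g eq = j≋̸g+u (≋-trans (≋-sym i+u≋j)
        (≋-+ u (residues (trans eq (sym (m<n⇒m%n≡m g<k))))))

  open Match

  weight : Bool → Core → ℕ
  weight b C = ∑ (λ j → indicator (fill b (letter C j))) k

  weight-per : ∀ b C → Periodic (λ j → indicator (fill b (letter C j)))
  weight-per b C j = cong (λ l → indicator (fill b l)) (letter-per C j)

  weight-false-match : ∀ {C E} → Match C E → weight false E ≡ suc (weight false C)
  weight-false-match {C} {E} M =
    ∑-bump (weight-per false C) (weight-per false E) (u M) at-u away
    where
    at-u : indicator (fill false (letter E (u M))) ≡
           suc (indicator (fill false (letter C (u M))))
    at-u rewrite up-u M | flat-u M = refl
    away : ∀ j → ¬ j ≋ u M →
           indicator (fill false (letter E j)) ≡ indicator (fill false (letter C j))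
    away j j≋̸u with j ≋? g M + u M
    ... | yes j≋v
      rewrite periodic-≋ (letter-per E) j≋v | periodic-≋ (letter-per C) j≋v
            | down-g+u M | flat-g+u M = refl
    ... | no j≋̸v = cong (λ l → indicator (fill false l)) (elsewhere M j j≋̸u j≋̸v)

  weight-true-match : ∀ {C E} → Match C E → weight true C ≡ suc (weight true E)
  weight-true-match {C} {E} M =
    ∑-bump (weight-per true E) (weight-per true C) (g M + u M) at-v away
    where
    at-v : indicator (fill true (letter C (g M + u M))) ≡
           suc (indicator (fill true (letter E (g M + u M))))
    at-v rewrite down-g+u M | flat-g+u M = refl
    away : ∀ j → ¬ j ≋ g M + u M →
           indicator (fill true (letter C j)) ≡ indicator (fill true (letter E j))
    away j j≋̸v with j ≋? u M
    ... | yes j≋u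
      rewrite periodic-≋ (letter-per E) j≋u | periodic-≋ (letter-per C) j≋u
            | up-u M | flat-u M = refl
    ... | no j≋̸u = cong (λ l → indicator (fill true l)) (sym (elsewhere M j j≋̸u j≋̸v))

  -- An opening bracket counts in both fillings, a closing one in neither, an unmatched position in
  -- one. So each letter contributes one plus its change of height, and the changes of height cancel
  -- over a turn.
  weight-sum : ∀ C → weight false C + weight true C ≡ k
  weight-sum C = +-cancelˡ-≡ (height C 0) _ _ (begin
    height C 0 + (weight false C + weight true C)  ≡⟨ telescope C k ⟨
    height C k + k                                 ≡⟨ cong (_+ k) (height-per C 0) ⟩
    height C 0 + k                                 ∎)
    where
    open ≡-Reasoning
    step : ∀ l {a b} → Follows l a b → b + 1 ≡
           a + (indicator (fill false l) + indicator (fill true l))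
    step up   {a} refl = sym (+-suc a 1)
    step down {b = b} refl = trans (+-comm b 1) (sym (+-identityʳ _))
    step flat (refl , refl) = refl
    telescope : ∀ C m → height C m + m ≡ height C 0 +
      (∑ (λ j → indicator (fill false (letter C j))) m +
       ∑ (λ j → indicator (fill true (letter C j))) m)
    telescope C zero = refl
    telescope C (suc m) = begin
      height C (suc m) + suc m           ≡⟨ +-assoc (height C (suc m)) 1 m ⟨
      height C (suc m) + 1 + m           ≡⟨ cong (_+ m) (step (letter C m) (follows C m)) ⟩
      height C m + (x + y) + m           ≡⟨ swap₂₃ (height C m) (x + y) m ⟩
      height C m + m + (x + y)           ≡⟨ cong (_+ (x + y)) (telescope C m) ⟩
      height C 0 + (a + b) + (x + y)     ≡⟨ regroup (height C 0) a b x y ⟩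
      height C 0 + ((a + x) + (b + y))   ≡⟨ cong (height C 0 +_) (cong₂ _+_ (∑-suc f m) (∑-suc e m)) ⟨
      height C 0 + (∑ f (suc m) + ∑ e (suc m)) ∎
      where
      f e : ℕ → ℕ
      f j = indicator (fill false (letter C j))
      e j = indicator (fill true (letter C j))
      x = f m
      y = e m
      a = ∑ f m
      b = ∑ e m
      swap₂₃ : ∀ p q r → p + q + r ≡ p + r + q
      swap₂₃ = solve-∀
      regroup : ∀ p a b x y → p + (a + b) + (x + y) ≡ p + ((a + x) + (b + y))
      regroup = solve-∀

  indicator-mono : ∀ l → indicator (fill false l) ≤ indicator (fill true l)
  indicator-mono up   = ≤-refl
  indicator-mono down = ≤-refl
  indicator-mono flat = z≤n

  weight-mono : ∀ C → weight false C ≤ weight true C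
  weight-mono C = ∑-mono k (λ {i} _ → indicator-mono (letter C i))

  flat-weight : ∀ C → letter C j ≡ flat → weight false C < weight true C
  flat-weight {j} C flat-j = begin-strict
    weight false C          ≡⟨ ∑-shift (weight-per false C) j ⟨
    a 0 + ∑ (a ∘ suc) k′    <⟨ +-mono-<-≤ at-0 (∑-mono k′ (λ {i} _ → indicator-mono (letter C (suc i + j)))) ⟩
    b 0 + ∑ (b ∘ suc) k′    ≡⟨ ∑-shift (weight-per true C) j ⟩
    weight true C           ∎
    where
    open ≤-Reasoning
    a b : ℕ → ℕ
    a i = indicator (fill false (letter C (i + j)))
    b i = indicator (fill true (letter C (i + j)))
    at-0 : a 0 < b 0
    at-0 rewrite flat-j = ≤-refl

  -- Longest arcs without unmatched positions

  FlatFree : Core → ℕ → ℕ → Set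
  FlatFree C i ℓ = ∀ j → j < ℓ → letter C (j + i) ≢ flat

  flatFree? : ∀ C i ℓ → Dec (FlatFree C i ℓ)
  flatFree? C i ℓ = map′ (λ free j j<ℓ → free j<ℓ) (λ free {j} → free j)
    (allUpTo? (λ j → ¬? (flat? (letter C (j + i)))) ℓ)

  flatFree-≋ : ∀ C {i i′ ℓ} → i ≋ i′ → FlatFree C i ℓ → FlatFree C i′ ℓ
  flatFree-≋ C {i} {i′} i≋i′ free j j<ℓ eq = free j j<ℓ
    (trans (periodic-≋ (letter-per C)
      (≋-trans (≡⇒≋ (+-comm j i)) (≋-trans (≋-+ j i≋i′) (≡⇒≋ (+-comm i′ j))))) eq)

  -- At most the one position left over can be unmatched. In contraposition, a core whose fillings
  -- differ in size by at least two has no flat-free stretch of length k′, which ends the search for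
  -- a longest one.
  flatFree-weight : ∀ C i → FlatFree C i k′ → weight true C ≤ suc (weight false C)
  flatFree-weight C i free = begin
    weight true C           ≡⟨ ∑-shift (weight-per true C) i ⟨
    ∑ b k                   ≡⟨ ∑-suc b k′ ⟩
    ∑ b k′ + b k′           ≤⟨ +-mono-≤ (≤-reflexive (∑-cong k′ same)) (one-more (letter C (k′ + i))) ⟩
    ∑ a k′ + suc (a k′)     ≡⟨ +-suc (∑ a k′) (a k′) ⟩
    suc (∑ a k′ + a k′)     ≡⟨ cong suc (∑-suc a k′) ⟨
    suc (∑ a k)             ≡⟨ cong suc (∑-shift (weight-per false C) i) ⟩
    suc (weight false C)    ∎
    where
    open ≤-Reasoning
    a b : ℕ → ℕ
    a j = indicator (fill false (letter C (j + i)))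
    b j = indicator (fill true (letter C (j + i)))
    one-more : ∀ l → indicator (fill true l) ≤ suc (indicator (fill false l))
    one-more up   = s≤s z≤n
    one-more down = z≤n
    one-more flat = ≤-refl
    nonflat : ∀ l → l ≢ flat → indicator (fill true l) ≡ indicator (fill false l)
    nonflat up   _ = refl
    nonflat down _ = refl
    nonflat flat l≢ = contradiction refl l≢
    same : ∀ {j} → j < k′ → b j ≡ a j
    same j<k′ = nonflat _ (free _ j<k′)

  -- The interior of the arc has `g M` - 1 positions, so the strict bound says that no flat-free
  -- stretch is longer than this interior. Ties are allowed.
  Longest : ∀ {C E} → Match C E → Set
  Longest {C} M = ∀ i ℓ → FlatFree C i ℓ → ℓ < g M

  -- This yields a switch from true to false below `m`. For `FlatFree`, which passes to shorter
  -- stretches, such a switch marks the maximal length.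
  last-true : ∀ {P : ℕ → Set} → (∀ n → Dec (P n)) → P 0 → ∀ m → ¬ P m →
              ∃ λ ℓ → ℓ < m × P ℓ × ¬ P (suc ℓ)
  last-true P? p₀ zero    ¬p = contradiction p₀ ¬p
  last-true P? p₀ (suc m) ¬p with P? m
  ... | yes p = m , ≤-refl , p , ¬p
  ... | no ¬pm = let ℓ , ℓ<m , rest = last-true P? p₀ m ¬pm in ℓ , m≤n⇒m≤1+n ℓ<m , rest

  longestArc : ∀ C → 2 + weight false C ≤ weight true C →
    ∃₂ λ u g → 0 < g × g < k × letter C u ≡ flat × letter C (g + u) ≡ flat ×
      (∀ i → 0 < i → i < g → letter C (i + u) ≢ flat) ×
      (∀ i ℓ → FlatFree C i ℓ → ℓ < g)
  longestArc C gap
    with ℓ , ℓ<k′ , (i , _ , free) , maximal ← last-true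
           (λ ℓ → anyUpTo? (λ i → flatFree? C i ℓ) k) (0 , z<s , λ _ ()) k′
           (λ (i , _ , free) → <⇒≱ gap (flatFree-weight C i free))
    = v , suc ℓ , z<s , s<s ℓ<k′ , flat-v , flat-1+ℓ+v , interior-v , longest
    where
    longest-≤ : ∀ i → ¬ FlatFree C i (suc ℓ)
    longest-≤ i free = maximal
      (i % k , m%n<n i k , flatFree-≋ C (≋-sym (%-≋ i)) free)
    -- The position just before the stretch: `i + k′` is i - 1 modulo k. Were it or the position
    -- just behind the stretch not flat, the stretch could be extended by it.
    v : ℕ
    v = i + k′
    1+j+v≋j+i : ∀ j → suc j + v ≋ j + i
    1+j+v≋j+i j = ≋-trans
      (≡⇒≋ (trans (cong suc (sym (+-assoc j i k′))) (sym (+-suc (j + i) k′)))) (+k-≋ (j + i))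
    interior-v : ∀ j → 0 < j → j < suc ℓ → letter C (j + v) ≢ flat
    interior-v (suc j) _ (s<s j<ℓ) eq =
      free j j<ℓ (trans (sym (periodic-≋ (letter-per C) (1+j+v≋j+i j))) eq)
    flat-v : letter C v ≡ flat
    flat-v with flat? (letter C v)
    ... | yes eq = eq
    ... | no neq = contradiction extended (longest-≤ v)
      where
      extended : FlatFree C v (suc ℓ)
      extended zero    _   = neq
      extended (suc j) j<ℓ = interior-v (suc j) z<s j<ℓ
    flat-1+ℓ+v : letter C (suc ℓ + v) ≡ flat
    flat-1+ℓ+v with flat? (letter C (suc ℓ + v))
    ... | yes eq = eq
    ... | no neq = contradiction extended (longest-≤ i)
      where
      extended : FlatFree C i (suc ℓ)
      extended j (s<s j≤ℓ) with m≤n⇒m<n∨m≡n j≤ℓ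
      ... | inj₁ j<ℓ  = free j j<ℓ
      ... | inj₂ refl = λ eq → neq (trans (periodic-≋ (letter-per C) (1+j+v≋j+i ℓ)) eq)
    longest : ∀ i ℓ′ → FlatFree C i ℓ′ → ℓ′ < suc ℓ
    longest i ℓ′ free′ with ℓ′ ≤? ℓ
    ... | yes ℓ′≤ℓ = s≤s ℓ′≤ℓ
    ... | no ℓ′≰ℓ = contradiction (λ j j<1+ℓ → free′ j (≤-trans j<1+ℓ (≰⇒> ℓ′≰ℓ))) (longest-≤ i)

  longestMatch : ∀ C → 2 + weight false C ≤ weight true C →
                 ∃₂ λ E (M : Match C E) → Longest M
  longestMatch C gap = joined (longestArc C gap)
    where
    from-match : ∀ {v ℓ} → (∀ i ℓ′ → FlatFree C i ℓ′ → ℓ′ < ℓ) →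
                 (∃₂ λ E (M : Match C E) → u M ≡ v × g M ≡ ℓ) →
                 ∃₂ λ E (M : Match C E) → Longest M
    from-match longest (E , M , _ , refl) = E , M , longest
    joined : _ → ∃₂ λ E (M : Match C E) → Longest M
    joined (v , ℓ , 0<ℓ , ℓ<k , flat-v , flat-ℓ+v , free , longest) =
      from-match {v} longest (match C v ℓ 0<ℓ ℓ<k flat-v flat-ℓ+v free)

  shift-match : ∀ s {C E} → Match C E → Match (shift s C) (shift s E)
  shift-match s {C} {E} M = record
    { u = u₀ ; g = g M ; 0<g = 0<g M ; g<k = g<k M
    ; flat-u = trans (periodic-≋ (letter-per C) (u₀+s≋u 0)) (flat-u M)
    ; flat-g+u = trans (periodic-≋ (letter-per C) (u₀+s≋u (g M))) (flat-g+u M)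
    ; interior = λ i 0<i i<g eq → interior M i 0<i i<g
        (trans (sym (periodic-≋ (letter-per C) (u₀+s≋u i))) eq)
    ; up-u = trans (periodic-≋ (letter-per E) (u₀+s≋u 0)) (up-u M)
    ; down-g+u = trans (periodic-≋ (letter-per E) (u₀+s≋u (g M))) (down-g+u M)
    ; elsewhere = λ j j≋̸u j≋̸v → elsewhere M (j + s)
        (λ eq → j≋̸u (≋-cancel s (≋-trans eq (≋-sym (u₀+s≋u 0)))))
        (λ eq → j≋̸v (≋-cancel s (≋-trans eq (≋-sym (u₀+s≋u (g M))))))
    ; base = trans (periodic-≋ (height-per E) (u₀+s≋u 0)) (base M)
    ; positive = λ i 0<i i≤g → subst (0 <_)
        (sym (periodic-≋ (height-per E) (u₀+s≋u i))) (positive M i 0<i i≤g)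
    ; return = trans (periodic-≋ (height-per E) (u₀+s≋u (suc (g M)))) (return M)
    }
    where
    u₀ : ℕ
    u₀ = u M + s * k′
    u₀+s≋u : ∀ i → i + u₀ + s ≋ i + u M
    u₀+s≋u i = ≋-trans (≡⇒≋ (cong (_+ s) (sym (+-assoc i (u M) _)))) (+sk′+s-≋ (i + u M) s)

  shift-longest : ∀ s {C E} (M : Match C E) → Longest M → Longest (shift-match s M)
  shift-longest s {C} M longest i ℓ free = longest (i + s) ℓ
    (λ j j<ℓ eq → free j j<ℓ (trans (cong (letter C) (+-assoc j i s)) eq))

  -- Injectivity of matching along longest arcs

  heights-differ : ∀ C D → (∀ j → letter C j ≡ letter D j) →
                   ∀ j → height C j + height D 0 ≡ height D j + height C 0
  heights-differ C D same zero    = +-comm (height C 0) (height D 0)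
  heights-differ C D same (suc j) =
    step (letter C j) (letter D j) (same j) (follows C j) (follows D j) (heights-differ C D same j)
    where
    step : ∀ l l′ {a b a′ b′ x y} → l ≡ l′ → Follows l a b → Follows l′ a′ b′ →
           a + x ≡ a′ + y → b + x ≡ b′ + y
    step up   up   _ refl refl eq = cong suc eq
    step down down _ refl refl eq = suc-injective eq
    step flat flat _ (refl , refl) (refl , refl) eq = eq

  -- Letters determine heights up to a constant only, and `E` may have no flat left to pin it. But
  -- both heights reach 0, at the openings of their arcs, and neither is ever negative, so the
  -- constant is 0.
  heights-agree : ∀ {C E C′ E′} → Match C E → Match C′ E′ →
                  (∀ j → letter E j ≡ letter E′ j) → ∀ j → height E j ≡ height E′ j
  heights-agree {E = E} {E′ = E′} M M′ same j =
    +-cancelʳ-≡ (height E′ 0) _ _ (trans (differ j) (cong (height E′ j +_)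
      (≤-antisym (from-base M differ) (from-base M′ (λ i → sym (differ i))))))
    where
    differ = heights-differ E E′ same
    from-base : ∀ {C E} {h : ℕ → ℕ} {x y} (M : Match C E) →
                (∀ i → height E i + x ≡ h i + y) → y ≤ x
    from-base {E = E} {h} {x} {y} M differ = begin
      y                      ≤⟨ m≤n+m y (h (u M)) ⟩
      h (u M) + y            ≡⟨ differ (u M) ⟨
      height E (u M) + x     ≡⟨ cong (_+ x) (base M) ⟩
      x                      ∎
      where open ≤-Reasoning

  -- The arc of M′ meets neither end of the arc of M, as the common height
  -- vanishes at u M and just after the closing point of M; so it is flat-free in C.
  other-arc-free : ∀ {C E C′ E′} (M : Match C E) (M′ : Match C′ E′) →
    (∀ j → letter E j ≡ letter E′ j) → (∀ j → height E j ≡ height E′ j) →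
    ¬ u M ≋ u M′ → FlatFree C (u M′) (g M′)
  other-arc-free {C} {E} {C′} {E′} M M′ same level u≋̸u′ j j<g′ flat-j
    with j + u M′ ≋? u M | j + u M′ ≋? g M + u M
  ... | yes at-u | _ = not-start j j<g′ at-u
    where
    not-start : ∀ j → j < g M′ → ¬ j + u M′ ≋ u M
    not-start zero    _    eq = u≋̸u′ (≋-sym eq)
    not-start (suc j) j<g′ eq = >⇒≢ (positive M′ (suc j) z<s (<⇒≤ j<g′))
      (trans (sym (level _)) (trans (periodic-≋ (height-per E) eq) (base M)))
  ... | no _ | yes at-v = >⇒≢ (positive M′ (suc j) z<s j<g′)
    (trans (sym (level _)) (trans (periodic-≋ (height-per E) 1+j≋) (return M)))
    where
    1+j≋ : suc j + u M′ ≋ suc (g M) + u M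
    1+j≋ = ≋-trans (≡⇒≋ (sym (+-comm (j + u M′) 1)))
      (≋-trans (≋-+ 1 at-v) (≡⇒≋ (+-comm (g M + u M) 1)))
  ... | no j≋̸u | no j≋̸v = nonflat j j<g′
    (trans (sym (same _)) (trans (elsewhere M _ j≋̸u j≋̸v) flat-j))
    where
    nonflat : ∀ j → j < g M′ → letter E′ (j + u M′) ≢ flat
    nonflat zero    _    eq with () ← trans (sym (up-u M′)) eq
    nonflat (suc j) j<g′ eq = interior M′ (suc j) z<s j<g′ (trans (sym (elsewhere M′ _ not-u not-v)) eq)
      where
      not-u : ¬ suc j + u M′ ≋ u M′
      not-u eq = 1+n≢0 (small≋ (<-trans j<g′ (g<k M′)) z<s (≋-cancel (u M′) eq))
      not-v : ¬ suc j + u M′ ≋ g M′ + u M′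
      not-v eq = <⇒≢ j<g′ (small≋ (<-trans j<g′ (g<k M′)) (g<k M′) (≋-cancel (u M′) eq))

  match-injective : ∀ {C E C′ E′} (M : Match C E) (M′ : Match C′ E′) →
    Longest M → Longest M′ → (∀ j → letter E j ≡ letter E′ j) →
    ∀ j → letter C j ≡ letter C′ j
  match-injective {C} {E} {C′} {E′} M M′ longest longest′ same = unmatched
    where
    level = heights-agree M M′ same

    u≋u′ : u M ≋ u M′
    u≋u′ with u M ≋? u M′
    ... | yes eq = eq
    -- The free stretch contains the opening end besides the interior, hence has g positions instead
    -- of g - 1. The extra position makes both comparisons strict and thus contradictory.
    ... | no neq = contradiction
      (longest _ _ (other-arc-free M M′ same level neq))
      (<-asym (longest′ _ _ (other-arc-free M′ M (sym ∘ same) (sym ∘ level) (neq ∘ ≋-sym))))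

    +u≋ : ∀ i → i + u M ≋ i + u M′
    +u≋ i = ≋-trans (≡⇒≋ (+-comm i (u M))) (≋-trans (≋-+ i u≋u′) (≡⇒≋ (+-comm (u M′) i)))

    -- With a common start, the shorter arc returns to height 0 at a point where the longer one
    -- still has positive height.
    g≮g′ : ∀ {C E C′ E′} (M : Match C E) (M′ : Match C′ E′) →
           (∀ j → height E j ≡ height E′ j) → (∀ i → i + u M ≋ i + u M′) → ¬ g M < g M′
    g≮g′ {E′ = E′} M M′ level +u≋ g<g′ = >⇒≢ (positive M′ (suc (g M)) z<s g<g′)
      (trans (sym (periodic-≋ (height-per E′) (+u≋ (suc (g M))))) (trans (sym (level _)) (return M)))

    g≡g′ : g M ≡ g M′
    g≡g′ = ≤-antisym (≮⇒≥ (g≮g′ M′ M (sym ∘ level) (≋-sym ∘ +u≋)))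
                     (≮⇒≥ (g≮g′ M M′ level +u≋))

    v≋v′ : g M + u M ≋ g M′ + u M′
    v≋v′ = ≋-trans (+u≋ (g M)) (≡⇒≋ (cong (_+ u M′) g≡g′))

    unmatched : ∀ j → letter C j ≡ letter C′ j
    unmatched j with j ≋? u M | j ≋? g M + u M
    ... | yes at-u | _ = trans (trans (periodic-≋ (letter-per C) at-u) (flat-u M))
      (sym (trans (periodic-≋ (letter-per C′) (≋-trans at-u u≋u′)) (flat-u M′)))
    ... | no _ | yes at-v = trans (trans (periodic-≋ (letter-per C) at-v) (flat-g+u M))
      (sym (trans (periodic-≋ (letter-per C′) (≋-trans at-v v≋v′)) (flat-g+u M′)))
    ... | no j≋̸u | no j≋̸v = trans (sym (elsewhere M j j≋̸u j≋̸v)) (trans (same j)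
      (elsewhere M′ j (λ eq → j≋̸u (≋-trans eq (≋-sym u≋u′)))
                      (λ eq → j≋̸v (≋-trans eq (≋-sym v≋v′)))))

  -- Filling with `w j` itself makes the condition empty at unmatched positions; at matched ones it
  -- says that the bracket is the one given by `w`.
  Compatible : (ℕ → Bool) → Core → Set
  Compatible w C = ∀ j → fill (w j) (letter C j) ≡ w j

  flatCore : Core
  flatCore = record
    { letter = λ _ → flat ; height = λ _ → 0
    ; letter-per = λ _ → refl ; height-per = λ _ → refl
    ; follows = λ _ → refl , refl }

  module _ {w : ℕ → Bool} (w-per : Periodic w) where

    Flat : Core → Bool → ℕ → Set
    Flat C b j = letter C j ≡ flat × w j ≡ b

    flat-with? : ∀ C b j → Dec (Flat C b j)
    flat-with? C b j = flat? (letter C j) ×-dec w j ≟ᵇ b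

    fill-all : ∀ C b → Compatible w C → ¬ (∃ λ j → j < k × Flat C b j) →
               ∀ j → fill (not b) (letter C j) ≡ w j
    fill-all C b compat none j = by-letter (letter C j) refl
      where
      by-letter : ∀ l → letter C j ≡ l → fill (not b) (letter C j) ≡ w j
      by-letter up   eq = trans (cong (fill (not b)) eq)
        (trans (sym (cong (fill (w j)) eq)) (compat j))
      by-letter down eq = trans (cong (fill (not b)) eq)
        (trans (sym (cong (fill (w j)) eq)) (compat j))
      by-letter flat eq = trans (cong (fill (not b)) eq) (sym (¬-not λ w≡b → none
        (j % k , m%n<n j k
        , trans (sym (periodic-% (letter-per C) j)) eq
        , trans (sym (periodic-% w-per j)) w≡b)))

    -- u is the last flat met with w = true, l the distance walked since, d the distance left.
    walk : ∀ C d u l → Flat C true u → Flat C false (d + (l + u)) →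
           (∀ i → 0 < i → i ≤ l → letter C (i + u) ≢ flat) →
           ∃₂ λ u g → Flat C true u × 0 < g × Flat C false (g + u) ×
             (∀ i → 0 < i → i < g → letter C (i + u) ≢ flat)
    walk C zero u zero (_ , w≡true) (_ , w≡false) _ with () ← trans (sym w≡true) w≡false
    walk C zero u (suc l) _ (flat-l , _) free = contradiction flat-l (free (suc l) z<s ≤-refl)
    walk C (suc d) u l start end free with flat-with? C false (suc l + u)
    ... | yes found = u , suc l , start , z<s , found , λ i 0<i i<1+l → free i 0<i (s≤s⁻¹ i<1+l)
    ... | no notFalse with flat? (letter C (suc l + u))
    ...   | yes flat-l = walk C d (suc l + u) 0
      (flat-l , ¬-not λ w≡false → notFalse (flat-l , w≡false))
      (subst (Flat C false) (sym (+-suc d (l + u))) end)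
      (λ i 0<i i≤0 → contradiction 0<i (≤⇒≯ i≤0))
    ...   | no ¬flat-l = walk C d u (suc l) start
      (subst (Flat C false) (sym (+-suc d (l + u))) end) extended
      where
      extended : ∀ i → 0 < i → i ≤ suc l → letter C (i + u) ≢ flat
      extended i 0<i i≤1+l with m≤n⇒m<n∨m≡n i≤1+l
      ... | inj₁ i<1+l = free i 0<i (s≤s⁻¹ i<1+l)
      ... | inj₂ refl  = ¬flat-l

    match-compatible : ∀ {C E} (M : Match C E) → Compatible w C →
      w (u M) ≡ true → w (g M + u M) ≡ false → Compatible w E
    match-compatible {C} {E} M compat wu wv j with j ≋? u M | j ≋? g M + u M
    ... | yes at-u | _ = trans
      (cong (fill (w j)) (trans (periodic-≋ (letter-per E) at-u) (up-u M)))
      (sym (trans (periodic-≋ w-per at-u) wu))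
    ... | no _ | yes at-v = trans
      (cong (fill (w j)) (trans (periodic-≋ (letter-per E) at-v) (down-g+u M)))
      (sym (trans (periodic-≋ w-per at-v) wv))
    ... | no j≋̸u | no j≋̸v = trans (cong (fill (w j)) (elsewhere M j j≋̸u j≋̸v)) (compat j)

    match-mixed : ∀ C → Compatible w C → ∃ (λ j → j < k × Flat C true j) →
                  ∃ (λ j → j < k × Flat C false j) →
                  ∃ λ E → Match C E × Compatible w E
    match-mixed C compat (i , _ , start) (j , _ , flat-j , wj≡false) = walked (offset i j)
      where
      joined : ∀ {v ℓ} → w v ≡ true → w (ℓ + v) ≡ false →
               (∃₂ λ E (M : Match C E) → u M ≡ v × g M ≡ ℓ) →
               ∃ λ E → Match C E × Compatible w E
      joined wv wℓ+v (E , M , refl , refl) = E , M , match-compatible M compat wv wℓ+v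
      found : (∃₂ λ v ℓ → Flat C true v × 0 < ℓ × Flat C false (ℓ + v) ×
                (∀ i → 0 < i → i < ℓ → letter C (i + v) ≢ flat)) →
              ∃ λ E → Match C E × Compatible w E
      found (v , ℓ , (flat-v , wv) , 0<ℓ , (flat-ℓ+v , wℓ+v) , free) =
        joined wv wℓ+v (match C v ℓ 0<ℓ ℓ<k flat-v flat-ℓ+v free)
        where
        -- `walk` records no bound on the arc. An arc of length k or more would meet its own start
        -- again at `k + v`, where the word is flat and reads `true`.
        ℓ<k : ℓ < k
        ℓ<k with <-cmp ℓ k
        ... | tri< lt _ _ = lt
        ... | tri≈ _ refl _ with () ← trans (sym wv) (trans (sym (w-per v))
                                        (trans (cong w (+-comm v k)) wℓ+v))
        ... | tri> _ _ k<ℓ = contradiction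
          (trans (cong (letter C) (+-comm k v)) (trans (letter-per C v) flat-v)) (free k z<s k<ℓ)
      walked : (∃ λ d → d < k × d + i ≋ j) → ∃ λ E → Match C E × Compatible w E
      walked (d , _ , d+i≋j) = found (walk C d i 0 start
        (trans (periodic-≋ (letter-per C) d+i≋j) flat-j , trans (periodic-≋ w-per d+i≋j) wj≡false)
        (λ i 0<i i≤0 → contradiction 0<i (≤⇒≯ i≤0)))

    -- Pairs are matched one at a time. While both letters occur among the flats, some flat `true`
    -- is followed by a flat `false` with no flat between them. Matching these two lowers
    -- `weight true`, so its bound `m` is the measure of the recursion.
    core-above : ∀ m C → Compatible w C → weight true C ≤ m →
                 ∃₂ λ b D → ∀ j → fill b (letter D j) ≡ w j
    core-above m C compat bound = by-flats
      (anyUpTo? (flat-with? C true) k) (anyUpTo? (flat-with? C false) k)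
      where
      smaller : ∀ m → weight true C ≤ m → (∃ λ E → Match C E × Compatible w E) →
                ∃₂ λ b D → ∀ j → fill b (letter D j) ≡ w j
      smaller m bound (E , M , compat′) with subst (_≤ m) (weight-true-match M) bound
      ... | s≤s bound′ = core-above _ E compat′ bound′
      by-flats : Dec (∃ λ j → j < k × Flat C true j) → Dec (∃ λ j → j < k × Flat C false j) →
                 ∃₂ λ b D → ∀ j → fill b (letter D j) ≡ w j
      by-flats (no none) _ = false , C , fill-all C true compat none
      by-flats (yes _) (no none) = true , C , fill-all C false compat none
      by-flats (yes some) (yes some′) = smaller m bound (match-mixed C compat some some′)

    core-exists : ∃₂ λ b C → ∀ j → fill b (letter C j) ≡ w j
    core-exists = core-above (weight true flatCore) flatCore (λ _ → refl) ≤-refl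

-- Symmetric chain decompositions of graded preorders

record GradedPreorder : Set₁ where
  field
    preorder : Preorder 0ℓ 0ℓ 0ℓ

  open Preorder preorder public
    renaming (refl to ≲-refl; trans to ≲-trans; reflexive to ≲-reflexive)

  field
    rank      : Carrier → ℕ
    top       : ℕ
    rank-cong : ∀ {x y} → x ≈ y → rank x ≡ rank y

  -- Comparability with a rank increase of one stands in for covering until the final transfer.
  -- Products and rank-preserving monotone maps keep it by arithmetic alone.
  _⋖ʳ_ : Carrier → Carrier → Set
  x ⋖ʳ y = x ≲ y × rank y ≡ suc (rank x)

  ⋖ʳ-resp-≈ : ∀ {x x′ y y′} → x ≈ x′ → y ≈ y′ → x ⋖ʳ y → x′ ⋖ʳ y′
  ⋖ʳ-resp-≈ x≈x′ y≈y′ (x≲y , eq) =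
    ≲-trans (≲-reflexive (Eq.sym x≈x′)) (≲-trans x≲y (≲-reflexive y≈y′)) ,
    trans (sym (rank-cong y≈y′)) (trans eq (cong suc (rank-cong x≈x′)))

  data Saturated : Carrier → Carrier → List Carrier → Set where
    [-] : ∀ {x} → Saturated x x [ x ]
    _∷_ : ∀ {x y z ys} → x ⋖ʳ y → Saturated y z ys → Saturated x z (x ∷ ys)

  Symmetric : List Carrier → Set
  Symmetric xs = ∃₂ λ x y → Saturated x y xs × rank x + rank y ≡ top

  -- Lists up to permutation serve as multisets: if `xs` lists every class exactly once, then so do
  -- the chains together, which gives disjointness and covering at the same time.
  Decomposes : List Carrier → Set
  Decomposes xs = ∃ λ css → All Symmetric css × concat css ↭ xs

  SCD : Set
  SCD = ∃ λ css → All Symmetric css × SetoidUnique.Unique Eq.setoid (concat css) ×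
    (∀ x → SetoidMembership._∈_ Eq.setoid x (concat css))

  decomposes⇒SCD : ∀ {xs} → Decomposes xs → SetoidUnique.Unique Eq.setoid xs →
                   (∀ x → SetoidMembership._∈_ Eq.setoid x xs) → SCD
  decomposes⇒SCD (css , sym-css , eq) unique complete =
    css , sym-css , 
    SetoidPermutationₚ.AllPairs-resp-↭ (setoid Carrier) (λ x≉y y≈x → x≉y (Eq.sym y≈x))
      (resp₂ _) (↭⇒↭ₛ (↭-sym eq)) unique ,
    λ x → Any-resp-↭ (↭-sym eq) (complete x)

  snoc : ∀ {x y z ys} → Saturated x y ys → y ⋖ʳ z → Saturated x z (ys ∷ʳ z)
  snoc [-]        y⋖z = y⋖z ∷ [-]
  snoc (x⋖y ∷ ch) z⋖w = x⋖y ∷ snoc ch z⋖w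

  decomposes-[] : Decomposes []
  decomposes-[] = [] , [] , ↭-refl

  decomposes-↭ : ∀ {xs ys} → xs ↭ ys → Decomposes xs → Decomposes ys
  decomposes-↭ xs↭ys (css , sym-css , eq) = css , sym-css , ↭-trans eq xs↭ys

  decomposes-++ : ∀ {xs ys} → Decomposes xs → Decomposes ys → Decomposes (xs ++ ys)
  decomposes-++ (css , sym-css , eq) (dss , sym-dss , eq′) =
    css ++ dss , Allₚ.++⁺ sym-css sym-dss ,
    ↭-trans (↭-reflexive (sym (concat-++ css dss))) (++⁺ eq eq′)

  decomposes-chain : ∀ {xs} → Symmetric xs → Decomposes xs
  decomposes-chain {xs} sym-xs =
    [ xs ] , sym-xs ∷ [] , ↭-reflexive (++-identityʳ xs)


module _ (P Q : GradedPreorder) where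
  private
    module P = GradedPreorder P
    module Q = GradedPreorder Q

  infixr 2 _×ᴳ_

  _×ᴳ_ : GradedPreorder
  _×ᴳ_ = record
    { preorder  = ×-preorder P.preorder Q.preorder
    ; rank      = λ (x , y) → P.rank x + Q.rank y
    ; top       = P.top + Q.top
    ; rank-cong = λ (x≈x′ , y≈y′) → cong₂ _+_ (P.rank-cong x≈x′) (Q.rank-cong y≈y′)
    }

module _ {P Q : GradedPreorder} where
  private
    module P = GradedPreorder P
    module Q = GradedPreorder Q

  module _ (f : P.Carrier → Q.Carrier)
           (mono : ∀ {x y} → x P.≲ y → f x Q.≲ f y)
           (rank-f : ∀ x → Q.rank (f x) ≡ P.rank x)
           (top-f : Q.top ≡ P.top) where

    map-saturated : ∀ {x y xs} → P.Saturated x y xs → Q.Saturated (f x) (f y) (map f xs)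
    map-saturated P.[-] = Q.[-]
    map-saturated ((x≲y , eq) P.∷ ch) =
      (mono x≲y , trans (rank-f _) (trans eq (cong suc (sym (rank-f _))))) Q.∷ map-saturated ch

    map-decomposes : ∀ {xs} → P.Decomposes xs → Q.Decomposes (map f xs)
    map-decomposes (css , sym-css , eq) =
      map (map f) css , Allₚ.map⁺ (All.map map-symmetric sym-css) ,
      ↭-trans (↭-reflexive (concat-map css)) (↭-map⁺ f eq)
      where
      map-symmetric : ∀ {xs} → P.Symmetric xs → Q.Symmetric (map f xs)
      map-symmetric (x , y , ch , eq) = f x , f y , map-saturated ch ,
        trans (cong₂ _+_ (rank-f x) (rank-f y)) (trans eq (sym top-f))

    map-SCD : (∀ {x y} → x P.≈ y → f x Q.≈ f y) → (∀ {x y} → f x Q.≈ f y → x P.≈ y) →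
              (∀ y → ∃ λ x → y Q.≈ f x) → P.SCD → Q.SCD
    map-SCD f-cong injective surjective (css , sym-css , unique , complete) =
      Q.decomposes⇒SCD (map-decomposes (css , sym-css , ↭-refl))
        (SetoidUniqueₚ.map⁺ P.Eq.setoid Q.Eq.setoid injective unique)
        λ y → let x , y≈fx = surjective y in
          SetoidMembershipₚ.∈-resp-≈ Q.Eq.setoid (Q.Eq.sym y≈fx)
            (SetoidMembershipₚ.∈-map⁺ P.Eq.setoid Q.Eq.setoid f-cong (complete x))

  private
    module P×Q = GradedPreorder (P ×ᴳ Q)

  right : ∀ {x y y′ ys} → Q.Saturated y y′ ys → P×Q.Saturated (x , y) (x , y′) (map (x ,_) ys)
  right Q.[-] = P×Q.[-]
  right ((y≲y′ , eq) Q.∷ ch) =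
    ((P.≲-refl , y≲y′) , trans (cong (P.rank _ +_) eq) (+-suc _ _)) P×Q.∷ right ch

  left : ∀ {x x′ y xs} → P.Saturated x x′ xs → P×Q.Saturated (x , y) (x′ , y) (map (_, y) xs)
  left P.[-] = P×Q.[-]
  left ((x≲x′ , eq) P.∷ ch) =
    ((x≲x′ , Q.≲-refl) , cong (_+ Q.rank _) eq) P×Q.∷ left ch

  hook : ∀ {x₀ x x′ y y′ xs ys} → Q.Saturated y y′ ys → x₀ P.⋖ʳ x → P.Saturated x x′ xs →
         P×Q.Saturated (x₀ , y) (x′ , y′) (map (x₀ ,_) ys ++ map (_, y′) xs)
  hook Q.[-] (x₀≲x , eq) ch = ((x₀≲x , Q.≲-refl) , cong (_+ Q.rank _) eq) P×Q.∷ left ch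
  hook ((y≲y′ , eq) Q.∷ ch) x₀⋖x ch′ =
    ((P.≲-refl , y≲y′) , trans (cong (P.rank _ +_) eq) (+-suc _ _)) P×Q.∷ hook ch x₀⋖x ch′

  data Unsnoc (y z : Q.Carrier) : List Q.Carrier → Set where
    single : y ≡ z → Unsnoc y z [ z ]
    init-last : ∀ {w ws} → Q.Saturated y w ws → w Q.⋖ʳ z → Unsnoc y z (ws ∷ʳ z)

  unsnoc : ∀ {y z ys} → Q.Saturated y z ys → Unsnoc y z ys
  unsnoc Q.[-] = single refl
  unsnoc (y⋖y′ Q.∷ ch) with unsnoc ch
  ... | single refl      = init-last Q.[-] y⋖y′
  ... | init-last ch′ w⋖z = init-last (y⋖y′ Q.∷ ch′) w⋖z

  cartesianProduct-∷ʳ : ∀ (xs : List P.Carrier) (ys : List Q.Carrier) z →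
    map (_, z) xs ++ cartesianProduct xs ys ↭ cartesianProduct xs (ys ∷ʳ z)
  cartesianProduct-∷ʳ []       ys z = ↭-refl
  cartesianProduct-∷ʳ (x ∷ xs) ys z = begin
    (x , z) ∷ map (_, z) xs ++ (map (x ,_) ys ++ cartesianProduct xs ys)
      ↭⟨ prep (x , z) (shifts (map (_, z) xs) (map (x ,_) ys)) ⟩
    (x , z) ∷ map (x ,_) ys ++ (map (_, z) xs ++ cartesianProduct xs ys)
      ↭⟨ ++⁺ (∷↭∷ʳ (x , z) (map (x ,_) ys)) (cartesianProduct-∷ʳ xs ys z) ⟩
    (map (x ,_) ys ∷ʳ (x , z)) ++ cartesianProduct xs (ys ∷ʳ z)
      ≡⟨ cong (_++ cartesianProduct xs (ys ∷ʳ z)) (map-++ (x ,_) ys [ z ]) ⟨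
    map (x ,_) (ys ∷ʳ z) ++ cartesianProduct xs (ys ∷ʳ z) ∎
    where open PermutationReasoning

  cartesianProduct-++ : ∀ (xs : List P.Carrier) (ys zs : List Q.Carrier) →
    cartesianProduct xs ys ++ cartesianProduct xs zs ↭ cartesianProduct xs (ys ++ zs)
  cartesianProduct-++ []       ys zs = ↭-refl
  cartesianProduct-++ (x ∷ xs) ys zs = begin
    (map (x ,_) ys ++ cartesianProduct xs ys) ++ (map (x ,_) zs ++ cartesianProduct xs zs)
      ≡⟨ ++-assoc (map (x ,_) ys) _ _ ⟩
    map (x ,_) ys ++ (cartesianProduct xs ys ++ (map (x ,_) zs ++ cartesianProduct xs zs))
      ↭⟨ ++⁺ˡ (map (x ,_) ys) (shifts (cartesianProduct xs ys) (map (x ,_) zs)) ⟩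
    map (x ,_) ys ++ (map (x ,_) zs ++ (cartesianProduct xs ys ++ cartesianProduct xs zs))
      ≡⟨ ++-assoc (map (x ,_) ys) _ _ ⟨
    (map (x ,_) ys ++ map (x ,_) zs) ++ (cartesianProduct xs ys ++ cartesianProduct xs zs)
      ↭⟨ ++⁺ (↭-reflexive (sym (map-++ (x ,_) ys zs))) (cartesianProduct-++ xs ys zs) ⟩
    map (x ,_) (ys ++ zs) ++ cartesianProduct xs (ys ++ zs) ∎
    where open PermutationReasoning

  interchange : ∀ a b c d → (a + b) + (c + d) ≡ (a + c) + (b + d)
  interchange = solve-∀

  -- The product of two chains splits into L-shaped chains: up the first column,
  -- then along the top row, and on with the rest.
  hooks : ∀ {x x′ y y′ xs ys} → P.Saturated x x′ xs → Q.Saturated y y′ ys →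
          (P.rank x + P.rank x′) + (Q.rank y + Q.rank y′) ≡ P×Q.top →
          P×Q.Decomposes (cartesianProduct xs ys)
  hooks {x} {y = y} {y′} {ys = ys} P.[-] ch eq =
    P×Q.decomposes-↭ (↭-reflexive (sym (++-identityʳ _)))
      (P×Q.decomposes-chain (_ , _ , right ch ,
        trans (interchange (P.rank x) (Q.rank y) (P.rank x) (Q.rank y′)) eq))
  hooks {x} {x′} {y} {y′} {ys = ys} (P._∷_ {y = x₁} {ys = xs} x⋖x₁ ch) ch′ eq =
    P×Q.decomposes-↭ rearranged (P×Q.decomposes-++ (P×Q.decomposes-chain
      (_ , _ , hook ch′ x⋖x₁ ch ,
        trans (interchange (P.rank x) (Q.rank y) (P.rank x′) (Q.rank y′)) eq)) (proj₁ (proj₂ rest)))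
    where
    -- What remains after the hook is again a product of two chains. The first one starts one rank
    -- higher and the second one ends one rank lower, so the rank sum is unchanged.
    shorten : ∀ a b c d → (suc a + b) + (c + d) ≡ (a + b) + (c + suc d)
    shorten = solve-∀
    rest : ∃ λ zs → P×Q.Decomposes zs ×
           map (_, y′) xs ++ zs ↭ cartesianProduct xs ys
    rest with unsnoc ch′
    ... | single refl = [] , P×Q.decomposes-[] ,
      ↭-trans (++⁺ˡ (map (_, y′) xs) (↭-reflexive (sym (cartesianProductWith-zeroʳ _,_ xs))))
        (cartesianProduct-∷ʳ xs [] y′)
    ... | init-last {w} {ws} ch″ w⋖y′ =
      cartesianProduct xs ws ,
      hooks ch ch″ (trans (cong (λ r → r + P.rank x′ + (Q.rank y + Q.rank w)) (proj₂ x⋖x₁))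
        (trans (shorten (P.rank x) (P.rank x′) (Q.rank y) (Q.rank w))
          (trans (cong (λ r → P.rank x + P.rank x′ + (Q.rank y + r)) (sym (proj₂ w⋖y′))) eq))) ,
      cartesianProduct-∷ʳ xs ws y′
    rearranged : (map (x ,_) ys ++ map (_, y′) xs) ++ proj₁ rest ↭
                 map (x ,_) ys ++ cartesianProduct xs ys
    rearranged = ↭-trans (↭-reflexive (++-assoc (map (x ,_) ys) _ _))
      (++⁺ˡ (map (x ,_) ys) (proj₂ (proj₂ rest)))

  decomposes-chain-× : ∀ {xs dss} → P.Symmetric xs → All Q.Symmetric dss →
                       P×Q.Decomposes (cartesianProduct xs (concat dss))
  decomposes-chain-× {xs} _ [] =
    P×Q.decomposes-↭ (↭-reflexive (sym (cartesianProductWith-zeroʳ _,_ xs))) P×Q.decomposes-[]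
  decomposes-chain-× {xs} {ys ∷ dss} sym-xs@(x , x′ , ch , eq) ((y , y′ , ch′ , eq′) ∷ sym-dss) =
    P×Q.decomposes-↭ (cartesianProduct-++ xs ys (concat dss))
      (P×Q.decomposes-++ (hooks ch ch′ (cong₂ _+_ eq eq′)) (decomposes-chain-× sym-xs sym-dss))

  decomposes-× : ∀ {css dss} → All P.Symmetric css → All Q.Symmetric dss →
                 P×Q.Decomposes (cartesianProduct (concat css) (concat dss))
  decomposes-× [] _ = P×Q.decomposes-[]
  decomposes-× {xs ∷ css} {dss} (sym-xs ∷ sym-css) sym-dss =
    P×Q.decomposes-↭
      (↭-reflexive (sym (cartesianProductWith-distribʳ-++ _,_ xs (concat css) (concat dss))))
      (P×Q.decomposes-++ (decomposes-chain-× sym-xs sym-dss) (decomposes-× sym-css sym-dss))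

  ×-SCD : P.SCD → Q.SCD → P×Q.SCD
  ×-SCD (css , sym-css , unique-css , complete-css) (dss , sym-dss , unique-dss , complete-dss) =
    P×Q.decomposes⇒SCD (decomposes-× sym-css sym-dss)
      (SetoidUniqueₚ.cartesianProduct⁺ P.Eq.setoid Q.Eq.setoid unique-css unique-dss)
      λ (x , y) → SetoidMembershipₚ.∈-cartesianProduct⁺ P.Eq.setoid Q.Eq.setoid
        (complete-css x) (complete-dss y)

-- Finite quotients and partitions into paths

allPairs-given : ∀ {a p r} {A : Set a} {P : A → Set p} {R : A → A → Set r} {xs} →
                 All P xs → AllPairs (λ x y → P x → P y → R x y) xs → AllPairs R xs
allPairs-given []         []         = []
allPairs-given (px ∷ pxs) (rx ∷ rxs) =
  All.zipWith (λ (py , r) → r px py) (pxs , rx) ∷ allPairs-given pxs rxs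

unique-lookup : ∀ {c ℓ} (S : Setoid c ℓ) {xs} → SetoidUnique.Unique S xs → ∀ i j →
                Setoid._≈_ S (lookup xs i) (lookup xs j) → i ≡ j
unique-lookup S (x∉ ∷ _) zero    zero    _  = refl
unique-lookup S (x∉ ∷ _) zero    (suc j) eq = contradiction eq (All.lookup x∉ (∈-lookup j))
unique-lookup S (x∉ ∷ _) (suc i) zero    eq =
  contradiction (Setoid.sym S eq) (All.lookup x∉ (∈-lookup i))
unique-lookup S (_ ∷ xs!) (suc i) (suc j) eq = cong suc (unique-lookup S xs! i j eq)

concatMap-↭ : ∀ {a b} {A : Set a} {B : Set b} (f : A → List B) {xs ys} →
              xs ↭ ys → concatMap f xs ↭ concatMap f ys
concatMap-↭ f Permutation.refl          = ↭-refl
concatMap-↭ f (Permutation.prep x p)    = ++⁺ˡ (f x) (concatMap-↭ f p)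
concatMap-↭ f (Permutation.swap x y p)  =
  ↭-trans (shifts (f x) (f y)) (++⁺ˡ (f y) (++⁺ˡ (f x) (concatMap-↭ f p)))
concatMap-↭ f (Permutation.trans p q)   = ↭-trans (concatMap-↭ f p) (concatMap-↭ f q)

-- Numbering the classes turns equivalence into equality of indices, so the combinatorics of paths
-- can take place in `Fin size`.
record FiniteQuotient (S : Setoid 0ℓ 0ℓ) : Set where
  open Setoid S using (Carrier; _≈_)
  field
    size        : ℕ
    rep         : Fin size → Carrier
    class       : Carrier → Fin size
    rep-class   : ∀ x → rep (class x) ≈ x
    rep-injective : ∀ i j → rep i ≈ rep j → i ≡ j

finiteQuotient : (S : DecSetoid 0ℓ 0ℓ) (xs : List (DecSetoid.Carrier S)) →
                 (∀ x → SetoidMembership._∈_ (DecSetoid.setoid S) x xs) →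
  FiniteQuotient (DecSetoid.setoid S)
finiteQuotient S xs every = record
  { size          = length ys
  ; rep           = lookup ys
  ; class         = λ x → Any.index (listed x)
  ; rep-class     = λ x → DecSetoid.sym S (Anyₚ.lookup-index (listed x))
  ; rep-injective = unique-lookup (DecSetoid.setoid S) (DecUniqueₚ.deduplicate-! S xs)
  }
  where
  open DecSetoid S using (Carrier) renaming (_≟_ to _≟ˢ_)
  ys : List Carrier
  ys = deduplicate _≟ˢ_ xs
  listed : ∀ x → SetoidMembership._∈_ (DecSetoid.setoid S) x ys
  listed = Enumeratesₚ.deduplicate⁺ S every

module Paths {n} (φ : Fin n → Fin n) (gap : Fin n → ℕ)
  (gap-φ : ∀ i → 2 ≤ gap i → gap i ≡ 2 + gap (φ i))
  (φ-injective : ∀ i j → 2 ≤ gap i → 2 ≤ gap j → φ i ≡ φ j → i ≡ j)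
  (bound : ℕ) (gap≤bound : ∀ i → gap i ≤ bound) where

  -- The number is meant to be the gap of the point. It drops by two per step and so drives the
  -- recursion; a gap of 0 or 1 ends the path.
  path : ℕ → Fin n → List (Fin n)
  path (suc (suc m)) i = i ∷ path m (φ i)
  path _             i = [ i ]

  fullPath : Fin n → List (Fin n)
  fullPath i = path (gap i) i

  gap-φ-≡ : ∀ {m} i → gap i ≡ 2 + m → gap (φ i) ≡ m
  gap-φ-≡ i eq = suc-injective (suc-injective
    (trans (sym (gap-φ i (subst (2 ≤_) (sym eq) (s≤s (s≤s z≤n))))) eq))

  data Reach (s : Fin n) : Fin n → Set where
    start : Reach s s
    step  : ∀ {y z} → Reach s y → 2 ≤ gap y → z ≡ φ y → Reach s z

  ∈-path⇒reach : ∀ m i {s y} → gap i ≡ m → Reach s i → y ∈ path m i → Reach s y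
  ∈-path⇒reach zero          i eq r (here refl) = r
  ∈-path⇒reach (suc zero)    i eq r (here refl) = r
  ∈-path⇒reach (suc (suc m)) i eq r (here refl) = r
  ∈-path⇒reach (suc (suc m)) i eq r (there y∈) = ∈-path⇒reach m (φ i) (gap-φ-≡ i eq)
    (step r (subst (2 ≤_) (sym eq) (s≤s (s≤s z≤n))) refl) y∈

  head-∈-path : ∀ m i → i ∈ path m i
  head-∈-path zero          i = here refl
  head-∈-path (suc zero)    i = here refl
  head-∈-path (suc (suc m)) i = here refl

  φ-∈-path : ∀ m i {y} → gap i ≡ m → y ∈ path m i → 2 ≤ gap y → φ y ∈ path m i
  φ-∈-path zero          i eq (here refl) 2≤ = contradiction (subst (2 ≤_) eq 2≤) λ ()
  φ-∈-path (suc zero)    i eq (here refl) 2≤ = contradiction (subst (2 ≤_) eq 2≤) λ { (s≤s ()) }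
  φ-∈-path (suc (suc m)) i eq (here refl) 2≤ = there (head-∈-path m (φ i))
  φ-∈-path (suc (suc m)) i eq (there y∈)    2≤ = there (φ-∈-path m (φ i) (gap-φ-≡ i eq) y∈ 2≤)

  reach⇒∈-path : ∀ {s y} → Reach s y → y ∈ fullPath s
  reach⇒∈-path {s} start           = head-∈-path (gap s) s
  reach⇒∈-path {s} (step r 2≤ refl) = φ-∈-path (gap s) s refl (reach⇒∈-path r) 2≤

  path-gap : ∀ m i {y} → gap i ≡ m → y ∈ path m i → gap y ≤ m
  path-gap zero          i eq (here refl) = ≤-reflexive eq
  path-gap (suc zero)    i eq (here refl) = ≤-reflexive eq
  path-gap (suc (suc m)) i eq (here refl) = ≤-reflexive eq
  path-gap (suc (suc m)) i eq (there y∈) =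
    ≤-trans (path-gap m (φ i) (gap-φ-≡ i eq) y∈) (m≤n+m m 2)

  path-unique : ∀ m i → gap i ≡ m → Unique (path m i)
  path-unique zero          i eq = [] ∷ []
  path-unique (suc zero)    i eq = [] ∷ []
  path-unique (suc (suc m)) i eq =
    -- The head cannot recur, since every later point has a smaller gap.
    All.tabulate (λ { y∈ refl → <⇒≱ (m<n+m m {2} z<s)
      (subst (_≤ m) eq (path-gap m (φ i) (gap-φ-≡ i eq) y∈)) }) ∷
    path-unique m (φ i) (gap-φ-≡ i eq)

  Start : Fin n → Set
  Start i = ¬ (∃ λ j → 2 ≤ gap j × φ j ≡ i)

  start? : ∀ i → Dec (Start i)
  start? i = ¬? (any? (λ j → 2 ≤? gap j ×-dec φ j ≟ᶠ i))

  starts : List (Fin n)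
  starts = filter start? (allFin n)

  reach-unique : ∀ {s t y} → Start s → Start t → Reach s y → Reach t y → s ≡ t
  reach-unique ¬s ¬t start start = refl
  reach-unique ¬s ¬t start (step _ 2≤ eq) = contradiction (_ , 2≤ , sym eq) ¬s
  reach-unique ¬s ¬t (step _ 2≤ eq) start = contradiction (_ , 2≤ , sym eq) ¬t
  reach-unique ¬s ¬t (step r 2≤ eq) (step r′ 2≤′ eq′)
    with refl ← φ-injective _ _ 2≤ 2≤′ (trans (sym eq) eq′) = reach-unique ¬s ¬t r r′

  -- Each step back along `φ` raises the gap by two while `bound` caps it. So the walk backwards
  -- stops at a start, and `m` bounds the number of steps it can still take.
  reached : ∀ m y → bound ≤ m + gap y → ∃ λ s → Start s × Reach s y
  reached m y bound≤ = by-start (any? (λ j → 2 ≤? gap j ×-dec φ j ≟ᶠ y))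
    where
    from : ∀ m j → bound ≤ m + gap (φ j) → 2 ≤ gap j → ∃ λ s → Start s × Reach s (φ j)
    from zero j bound≤ 2≤ = contradiction
      (≤-trans (≤-trans (≤-reflexive (sym (gap-φ j 2≤))) (gap≤bound j)) bound≤)
      (<⇒≱ (m<n+m (gap (φ j)) {2} z<s))
    from (suc m) j bound≤ 2≤ =
      let s , s-start , r = reached m j bound≤m+gap in s , s-start , step r 2≤ refl
      where
      open ≤-Reasoning
      bound≤m+gap : bound ≤ m + gap j
      bound≤m+gap = begin
        bound                   ≤⟨ bound≤ ⟩
        suc m + gap (φ j)       ≡⟨ +-suc m _ ⟨
        m + suc (gap (φ j))     ≤⟨ +-monoʳ-≤ m (n≤1+n _) ⟩
        m + (2 + gap (φ j))     ≡⟨ cong (m +_) (gap-φ j 2≤) ⟨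
        m + gap j               ∎
    by-start : Dec (∃ λ j → 2 ≤ gap j × φ j ≡ y) → ∃ λ s → Start s × Reach s y
    by-start (no none)              = y , none , start
    by-start (yes (j , 2≤ , refl)) = from m j bound≤ 2≤

  paths-partition : concatMap fullPath starts ↭ allFin n
  paths-partition = ∼bag⇒↭ (unique∧set⇒bag unique (Uniqueₚ.allFin⁺ n)
    (mk⇔ (λ _ → ∈-allFin _) (λ _ → covered _)))
    where
    paths-disjoint : ∀ {s t} → s ≢ t → Start s → Start t →
                     Disjoint (setoid (Fin n)) (fullPath s) (fullPath t)
    paths-disjoint {s} {t} s≢t ¬s ¬t (y∈s , y∈t) = s≢t (reach-unique ¬s ¬t
      (∈-path⇒reach (gap s) s refl start y∈s) (∈-path⇒reach (gap t) t refl start y∈t))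
    unique : Unique (concatMap fullPath starts)
    unique = Uniqueₚ.concat⁺
      (Allₚ.map⁺ (All.universal (λ i → path-unique (gap i) i refl) starts))
      (AllPairsₚ.map⁺ (allPairs-given (Allₚ.all-filter start? (allFin n))
        (AllPairs.map paths-disjoint (Uniqueₚ.filter⁺ start? (Uniqueₚ.allFin⁺ n)))))
    covered : ∀ y → y ∈ concatMap fullPath starts
    covered y with s , s-start , r ← reached bound y (m≤m+n bound (gap y)) =
      ∈-concatMap⁺ fullPath (lose (∈-filter⁺ start? (∈-allFin s) s-start) (reach⇒∈-path r))

-- The chains sought are lo c , lo (next c) , … , hi (next c) , hi c.
record NestedPairs (P : GradedPreorder) : Set₁ where
  open GradedPreorder P
  field
    _≈?_     : ∀ x y → Dec (x ≈ y)
    points   : List Carrier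
    every    : ∀ x → SetoidMembership._∈_ Eq.setoid x points
    Pair     : Set
    lo hi    : Pair → Carrier
    next     : Pair → Pair
    lo+hi    : ∀ c → rank (lo c) + rank (hi c) ≡ top
    lo≤hi    : ∀ c → rank (lo c) ≤ rank (hi c)
    lo≲hi    : ∀ c → lo c ≲ hi c
    balanced : ∀ c → rank (lo c) ≡ rank (hi c) → lo c ≈ hi c
    lo⋖next  : ∀ c → 2 + rank (lo c) ≤ rank (hi c) → lo c ⋖ʳ lo (next c)
    next⋖hi  : ∀ c → 2 + rank (lo c) ≤ rank (hi c) → hi (next c) ⋖ʳ hi c
    next-injective : ∀ c d → 2 + rank (lo c) ≤ rank (hi c) → 2 + rank (lo d) ≤ rank (hi d) →
                     lo (next c) ≈ lo (next d) → lo c ≈ lo d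
    lo⇒hi    : ∀ c d → lo c ≈ lo d → hi c ≈ hi d
    hi⇒lo    : ∀ c d → hi c ≈ hi d → lo c ≈ lo d
    pair     : ∀ x → ∃ λ c → x ≈ lo c ⊎ x ≈ hi c

module Nested (P : GradedPreorder) (N : NestedPairs P) where
  open GradedPreorder P
  open NestedPairs N

  -- Both pairs have rank sum `top`, so `lo c ≈ hi d` forces equal ranks for `hi c` and `lo d`. Then
  -- `lo≤hi` for c reads as the reverse of `lo≤hi` for d, and the pair d is balanced.
  lo≈hi⇒lo≈lo : ∀ c d → lo c ≈ hi d → lo c ≈ lo d × rank (lo d) ≡ rank (hi d)
  lo≈hi⇒lo≈lo c d lo≈hi = Eq.trans lo≈hi (Eq.sym (balanced d lo≡hi)) , lo≡hi
    where
    hi-c≡lo-d : rank (hi c) ≡ rank (lo d)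
    hi-c≡lo-d = +-cancelˡ-≡ (rank (lo c)) _ _ (trans (lo+hi c)
      (trans (sym (lo+hi d)) (trans (+-comm (rank (lo d)) _)
        (cong (_+ rank (lo d)) (sym (rank-cong lo≈hi))))))
    lo≡hi : rank (lo d) ≡ rank (hi d)
    lo≡hi = ≤-antisym (lo≤hi d)
      (subst₂ _≤_ (rank-cong lo≈hi) hi-c≡lo-d (lo≤hi c))

  lows : DecSetoid 0ℓ 0ℓ
  lows = record
    { Carrier = Pair ; _≈_ = λ c d → lo c ≈ lo d
    ; isDecEquivalence = record
      { isEquivalence = record { refl = Eq.refl ; sym = Eq.sym ; trans = Eq.trans }
      ; _≟_ = λ c d → lo c ≈? lo d } }

  -- Pairs themselves are not enumerated; in the application they contain functions on ℕ. Every
  -- class is met by the pair chosen for some point, namely for `lo c`. If that pair d has `lo c` as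
  -- its upper end, d is balanced and lies in the class all the same.
  quotient : FiniteQuotient (DecSetoid.setoid lows)
  quotient = finiteQuotient lows (map (proj₁ ∘ pair) points) listed
    where
    found : ∀ c {x} → lo c ≈ x → lo c ≈ lo (proj₁ (pair x))
    found c {x} lo≈x with pair x
    ... | d , inj₁ x≈lo = Eq.trans lo≈x x≈lo
    ... | d , inj₂ x≈hi = proj₁ (lo≈hi⇒lo≈lo c d (Eq.trans lo≈x x≈hi))
    listed : ∀ c → SetoidMembership._∈_ (DecSetoid.setoid lows) c (map (proj₁ ∘ pair) points)
    listed c = Anyₚ.map⁺ (Any.map (found c) (every (lo c)))

  module Quotiented (Q : FiniteQuotient (DecSetoid.setoid lows)) where
    open FiniteQuotient Q

    L H : Fin size → Carrier
    L i = lo (rep i)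
    H i = hi (rep i)

    φ : Fin size → Fin size
    φ i = class (next (rep i))

    gap : Fin size → ℕ
    gap i = rank (H i) ∸ rank (L i)

    rank-H : ∀ i → rank (H i) ≡ gap i + rank (L i)
    rank-H i = sym (m∸n+n≡m (lo≤hi (rep i)))

    gap⇒rank : ∀ i → 2 ≤ gap i → 2 + rank (L i) ≤ rank (H i)
    gap⇒rank i 2≤ = subst (2 + rank (L i) ≤_) (sym (rank-H i)) (+-monoˡ-≤ (rank (L i)) 2≤)

    L⋖ : ∀ i → 2 ≤ gap i → L i ⋖ʳ L (φ i)
    L⋖ i 2≤ = ⋖ʳ-resp-≈ Eq.refl (Eq.sym (rep-class _)) (lo⋖next (rep i) (gap⇒rank i 2≤))

    ⋖H : ∀ i → 2 ≤ gap i → H (φ i) ⋖ʳ H i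
    ⋖H i 2≤ = ⋖ʳ-resp-≈ (Eq.sym (lo⇒hi _ _ (rep-class _))) Eq.refl
      (next⋖hi (rep i) (gap⇒rank i 2≤))

    gap-φ : ∀ i → 2 ≤ gap i → gap i ≡ 2 + gap (φ i)
    gap-φ i 2≤ = +-cancelʳ-≡ (rank (L i)) _ _ (begin
      gap i + rank (L i)                  ≡⟨ rank-H i ⟨
      rank (H i)                          ≡⟨ proj₂ (⋖H i 2≤) ⟩
      suc (rank (H (φ i)))                ≡⟨ cong suc (rank-H (φ i)) ⟩
      suc (gap (φ i) + rank (L (φ i)))    ≡⟨ cong (λ r → suc (gap (φ i) + r)) (proj₂ (L⋖ i 2≤)) ⟩
      suc (gap (φ i) + suc (rank (L i)))  ≡⟨ cong suc (+-suc (gap (φ i)) _) ⟩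
      2 + gap (φ i) + rank (L i)          ∎)
      where open ≡-Reasoning

    φ-injective : ∀ i j → 2 ≤ gap i → 2 ≤ gap j → φ i ≡ φ j → i ≡ j
    φ-injective i j 2≤i 2≤j eq = rep-injective i j
      (next-injective _ _ (gap⇒rank i 2≤i) (gap⇒rank j 2≤j)
        (Eq.trans (Eq.sym (rep-class _)) (Eq.trans (Eq.reflexive (cong L eq)) (rep-class _))))

    gap≤top : ∀ i → gap i ≤ top
    gap≤top i = begin
      gap i                    ≤⟨ m≤m+n (gap i) (rank (L i)) ⟩
      gap i + rank (L i)       ≡⟨ rank-H i ⟨
      rank (H i)               ≤⟨ m≤n+m _ (rank (L i)) ⟩
      rank (L i) + rank (H i)  ≡⟨ lo+hi (rep i) ⟩
      top                      ∎
      where open ≤-Reasoning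

    open Paths φ gap gap-φ φ-injective top gap≤top

    -- At gap 0 the two ends are equivalent and may be listed only once, as the whole list must be
    -- free of repetitions up to `≈`.
    endsAt : ℕ → Fin size → List Carrier
    endsAt zero    i = [ L i ]
    endsAt (suc _) i = L i ∷ H i ∷ []

    ends : Fin size → List Carrier
    ends i = endsAt (gap i) i

    -- Built from the inside: the chain of `φ i` is enclosed by `L i` and `H i`. At gap 0 the
    -- innermost chain is `L i` alone, which is `H i` only up to equivalence; hence the separate end
    -- `y`.
    chain : ∀ m i → gap i ≡ m →
            ∃₂ λ y xs → y ≈ H i × Saturated (L i) y xs × xs ↭ concatMap ends (path m i)
    chain zero i eq = L i , [ L i ] ,
      balanced (rep i) (sym (trans (rank-H i) (cong (_+ rank (L i)) eq))) , [-] ,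
      ↭-reflexive (sym (trans (++-identityʳ _) (cong (λ m → endsAt m i) eq)))
    chain (suc zero) i eq = H i , L i ∷ H i ∷ [] , Eq.refl ,
      (lo≲hi (rep i) , trans (rank-H i) (cong (_+ rank (L i)) eq)) ∷ [-] ,
      ↭-reflexive (sym (trans (++-identityʳ _) (cong (λ m → endsAt m i) eq)))
    chain (suc (suc m)) i eq with chain m (φ i) (gap-φ-≡ i eq)
    ... | y , xs , y≈H , ch , xs↭ = H i , L i ∷ (xs ∷ʳ H i) , Eq.refl ,
      L⋖ i 2≤ ∷ snoc ch (⋖ʳ-resp-≈ (Eq.sym y≈H) Eq.refl (⋖H i 2≤)) ,
      (begin
        L i ∷ (xs ∷ʳ H i)                              ↭⟨ prep (L i) (∷↭∷ʳ (H i) xs) ⟨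
        endsAt (2 + m) i ++ xs                         ≡⟨ cong (λ m → endsAt m i ++ xs) eq ⟨
        ends i ++ xs                                   ↭⟨ ++⁺ˡ (ends i) xs↭ ⟩
        ends i ++ concatMap ends (path m (φ i))        ∎)
      where
      open PermutationReasoning
      2≤ : 2 ≤ gap i
      2≤ = subst (2 ≤_) (sym eq) (s≤s (s≤s z≤n))

    decomposes-paths : ∀ ss → Decomposes (concatMap ends (concatMap fullPath ss))
    decomposes-paths []       = decomposes-[]
    decomposes-paths (s ∷ ss) with chain (gap s) s refl
    ... | y , xs , y≈H , ch , xs↭ = decomposes-↭
      (↭-reflexive (sym (concatMap-++ ends (fullPath s) (concatMap fullPath ss))))
      (decomposes-++
        (decomposes-↭ xs↭ (decomposes-chain (_ , _ , ch ,
          trans (cong (rank (L s) +_) (rank-cong y≈H)) (lo+hi (rep s)))))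
        (decomposes-paths ss))

    ∈-ends : ∀ m i {x} → SetoidMembership._∈_ Eq.setoid x (endsAt m i) →
             x ≈ L i ⊎ (x ≈ H i × 0 < m)
    ∈-ends zero    i (here x≈L)         = inj₁ x≈L
    ∈-ends (suc m) i (here x≈L)         = inj₁ x≈L
    ∈-ends (suc m) i (there (here x≈H)) = inj₂ (x≈H , z<s)

    L≉H : ∀ i j → 0 < gap j → ¬ L i ≈ H j
    L≉H i j 0<gap L≈H = >⇒≢ 0<gap
      (trans (cong (_∸ rank (L j)) (sym (proj₂ (lo≈hi⇒lo≈lo _ _ L≈H)))) (n∸n≡0 (rank (L j))))

    ends-unique : ∀ m i → gap i ≡ m → SetoidUnique.Unique Eq.setoid (endsAt m i)
    ends-unique zero    i eq = [] ∷ []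
    ends-unique (suc m) i eq = (L≉H i i (subst (0 <_) (sym eq) z<s) ∷ []) ∷ [] ∷ []

    ends-disjoint : ∀ {i j} → i ≢ j → Disjoint Eq.setoid (ends i) (ends j)
    ends-disjoint {i} {j} i≢j (x∈i , x∈j) with ∈-ends (gap i) i x∈i | ∈-ends (gap j) j x∈j
    ... | inj₁ x≈Li       | inj₁ x≈Lj         = i≢j (rep-injective i j (Eq.trans (Eq.sym x≈Li) x≈Lj))
    ... | inj₁ x≈Li       | inj₂ (x≈Hj , 0<)  = L≉H i j 0< (Eq.trans (Eq.sym x≈Li) x≈Hj)
    ... | inj₂ (x≈Hi , 0<) | inj₁ x≈Lj        = L≉H j i 0< (Eq.trans (Eq.sym x≈Lj) x≈Hi)
    ... | inj₂ (x≈Hi , _) | inj₂ (x≈Hj , _)   =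
      i≢j (rep-injective i j (hi⇒lo _ _ (Eq.trans (Eq.sym x≈Hi) x≈Hj)))

    L∈ends : ∀ m i {x} → x ≈ L i → SetoidMembership._∈_ Eq.setoid x (endsAt m i)
    L∈ends zero    i x≈L = here x≈L
    L∈ends (suc m) i x≈L = here x≈L

    H∈ends : ∀ m i {x} → gap i ≡ m → x ≈ H i → SetoidMembership._∈_ Eq.setoid x (endsAt m i)
    H∈ends zero i eq x≈H = here (Eq.trans x≈H (Eq.sym
      (balanced (rep i) (sym (trans (rank-H i) (cong (_+ rank (L i)) eq))))))
    H∈ends (suc m) i eq x≈H = there (here x≈H)

    quotiented-SCD : SCD
    quotiented-SCD = decomposes⇒SCD
      (decomposes-↭ (concatMap-↭ ends paths-partition) (decomposes-paths starts))
      (SetoidUniqueₚ.concat⁺ Eq.setoid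
        (Allₚ.map⁺ (All.universal (λ i → ends-unique (gap i) i refl) (allFin size)))
        (AllPairsₚ.map⁺ (AllPairs.map ends-disjoint (Uniqueₚ.allFin⁺ size))))
      λ x → Anyₚ.concatMap⁺ ends (complete x)
      where
      complete : ∀ x → Any (λ i → SetoidMembership._∈_ Eq.setoid x (ends i)) (allFin size)
      complete x with pair x
      ... | c , inj₁ x≈lo = lose (∈-allFin (class c))
        (L∈ends _ (class c) (Eq.trans x≈lo (Eq.sym (rep-class c))))
      ... | c , inj₂ x≈hi = lose (∈-allFin (class c))
        (H∈ends _ (class c) refl (Eq.trans x≈hi (Eq.sym (lo⇒hi _ _ (rep-class c)))))

  nested-SCD : SCD
  nested-SCD = Quotiented.quotiented-SCD quotient

-- The quotient by the rotations of one cycle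

subsets : ∀ n → List (Subset n)
subsets zero    = [ [] ]
subsets (suc n) = map (inside ∷_) (subsets n) ++ map (outside ∷_) (subsets n)

∈-subsets : ∀ {n} (A : Subset n) → A ∈ subsets n
∈-subsets []            = here refl
∈-subsets (inside  ∷ A) = ∈-++⁺ˡ (∈-map⁺ (inside ∷_) (∈-subsets A))
∈-subsets (outside ∷ A) = ∈-++⁺ʳ _ (∈-map⁺ (outside ∷_) (∈-subsets A))

-- The cycle point 0 , … , point k′ on which the group acts by j ↦ j + r.
record Block (n : ℕ) : Set where
  field
    k′          : ℕ
    r           : ℕ
    point       : ℕ → Fin n
    index       : Fin n → ℕ
    point-per   : ∀ j → point (j + suc k′) ≡ point j
    index-point : ∀ j → index (point j) ≡ j % suc k′

module BlockOrder {n} (b : Block n) where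
  open Block b
  open Cyclic k′
  open Core

  word : Subset n → ℕ → Bool
  word A j = lookupᵛ A (point j)

  word-per : ∀ A → Periodic (word A)
  word-per A j = cong (lookupᵛ A) (point-per j)

  fromWord : (ℕ → Bool) → Subset n
  fromWord w = tabulate (w ∘ index)

  word-fromWord : ∀ {w} → Periodic w → ∀ j → word (fromWord w) j ≡ w j
  word-fromWord {w} per j = trans (lookup∘tabulate (w ∘ index) (point j))
    (trans (cong w (index-point j)) (sym (periodic-% per j)))

  infix 4 _~_ _≲ᴮ_

  -- Only points of the block are inspected, so subsets of the whole ground set represent subsets of
  -- the cycle and all blocks share one carrier. A natural number of turns suffices because -1 turn
  -- equals k′ turns.
  record _~_ (A B : Subset n) : Set where
    constructor turn
    field
      turns : ℕ
      agree : ∀ j → word A j ≡ word B (j + turns * r)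

  record _≲ᴮ_ (A B : Subset n) : Set where
    constructor turn
    field
      turns : ℕ
      below : ∀ j → word A j ≤ᴮ word B (j + turns * r)

  agree⇒~ : ∀ {A B} → (∀ j → word A j ≡ word B j) → A ~ B
  agree⇒~ {B = B} eq = turn 0 λ j → trans (eq j) (cong (word B) (sym (+-identityʳ j)))

  below⇒≲ : ∀ {A B} → (∀ j → word A j ≤ᴮ word B j) → A ≲ᴮ B
  below⇒≲ {A} {B} le = turn 0 λ j → subst (λ i → word A j ≤ᴮ word B i) (sym (+-identityʳ j)) (le j)

  turn-turn : ∀ j q q′ → j + q * r + q′ * r ≡ j + (q + q′) * r
  turn-turn j q q′ = trans (+-assoc j _ _) (cong (j +_) (sym (*-distribʳ-+ r q q′)))

  ~-sym : ∀ {A B} → A ~ B → B ~ A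
  ~-sym {A} {B} (turn q eq) = turn (q * k′) λ j → begin
    word B j                           ≡⟨ periodic-≋ (word-per B) (+sk′+s-≋ j (q * r)) ⟨
    word B (j + q * r * k′ + q * r)    ≡⟨ eq (j + q * r * k′) ⟨
    word A (j + q * r * k′)            ≡⟨ cong (λ x → word A (j + x)) (*-swap q r k′) ⟩
    word A (j + q * k′ * r)            ∎
    where
    open ≡-Reasoning
    *-swap : ∀ a b c → a * b * c ≡ a * c * b
    *-swap a b c = trans (*-assoc a b c) (trans (cong (a *_) (*-comm b c)) (sym (*-assoc a c b)))

  ~-trans : ∀ {A B C} → A ~ B → B ~ C → A ~ C
  ~-trans {C = C} (turn q eq) (turn q′ eq′) = turn (q + q′) λ j →
    trans (eq j) (trans (eq′ _) (cong (word C) (turn-turn j q q′)))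

  ≲-trans : ∀ {A B C} → A ≲ᴮ B → B ≲ᴮ C → A ≲ᴮ C
  ≲-trans {A} {C = C} (turn q le) (turn q′ le′) = turn (q + q′) λ j →
    subst (λ i → word A j ≤ᴮ word C i) (turn-turn j q q′) (Boolₚ.≤-trans (le j) (le′ _))

  size : Subset n → ℕ
  size A = ∑ (indicator ∘ word A) k

  size-cong : ∀ {A B} → A ~ B → size A ≡ size B
  size-cong {A} {B} (turn q eq) = trans (∑-cong k (λ {i} _ → cong indicator (eq i)))
    (∑-shift (periodic-∘ indicator (word-per B)) (q * r))

  graded : GradedPreorder
  graded = record
    { preorder = record
      { Carrier    = Subset n
      ; _≈_        = _~_
      ; _≲_        = _≲ᴮ_
      ; isPreorder = record
        { isEquivalence = record
          { refl = agree⇒~ (λ _ → refl) ; sym = ~-sym ; trans = ~-trans }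
        ; reflexive = λ (turn q eq) → turn q (λ j → Boolₚ.≤-reflexive (eq j))
        ; trans     = ≲-trans
        }
      }
    ; rank      = size
    ; top       = k
    ; rank-cong = size-cong
    }

  -- Positions and numbers of turns both matter only modulo k, so a finite search decides.
  _~?_ : ∀ A B → Dec (A ~ B)
  A ~? B = map′ to from (anyUpTo? (λ q → allUpTo? (λ j → word A j Boolₚ.≟ word B (j + q * r)) k) k)
    where
    to : (∃ λ q → q < k × (∀ {j} → j < k → word A j ≡ word B (j + q * r))) → A ~ B
    to (q , _ , eq) = turn q λ j → begin
      word A j                 ≡⟨ periodic-% (word-per A) j ⟩
      word A (j % k)           ≡⟨ eq (m%n<n j k) ⟩
      word B (j % k + q * r)   ≡⟨ periodic-≋ (word-per B) (≋-+ (q * r) (%-≋ j)) ⟩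
      word B (j + q * r)       ∎
      where open ≡-Reasoning
    reduce : ∀ q j → j + q * r ≋ j + q % k * r
    reduce q j = ≋-trans (≡⇒≋ (+-comm j (q * r))) (≋-trans (≋-+ j (residues (begin
      (q * r) % k                      ≡⟨ %-distribˡ-* q r k ⟩
      ((q % k) * (r % k)) % k          ≡⟨ cong (λ x → (x * (r % k)) % k) (m%n%n≡m%n q k) ⟨
      ((q % k % k) * (r % k)) % k      ≡⟨ %-distribˡ-* (q % k) r k ⟨
      (q % k * r) % k                  ∎))) (≡⇒≋ (+-comm (q % k * r) j)))
      where open ≡-Reasoning
    from : A ~ B → ∃ λ q → q < k × (∀ {j} → j < k → word A j ≡ word B (j + q * r))
    from (turn q eq) = q % k , m%n<n q k , λ {j} _ →
      trans (eq j) (periodic-≋ (word-per B) (reduce q j))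

  filled : Bool → Core → Subset n
  filled b C = fromWord (fill b ∘ letter C)

  word-filled : ∀ b C j → word (filled b C) j ≡ fill b (letter C j)
  word-filled b C = word-fromWord (periodic-∘ (fill b) (letter-per C))

  size-filled : ∀ b C → size (filled b C) ≡ weight b C
  size-filled b C = ∑-cong k (λ {i} _ → cong indicator (word-filled b C i))

  below-filled : ∀ b b′ C D → (∀ j → fill b (letter C j) ≤ᴮ fill b′ (letter D j)) →
                 filled b C ≲ᴮ filled b′ D
  below-filled b b′ C D le = below⇒≲ λ j →
    subst₂ _≤ᴮ_ (sym (word-filled b C j)) (sym (word-filled b′ D j)) (le j)

  letters⇒~ : ∀ b C D q → (∀ j → letter C j ≡ letter D (j + q * r)) → filled b C ~ filled b D
  letters⇒~ b C D q eq = turn q λ j → trans (word-filled b C j)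
    (trans (cong (fill b) (eq j)) (sym (word-filled b D _)))

  ~⇒letters : ∀ b C D → filled b C ~ filled b D →
              ∃ λ q → ∀ j → letter C j ≡ letter D (j + q * r)
  ~⇒letters b C D (turn q eq) = q , fill-injective b C (shift (q * r) D) λ j →
    trans (sym (word-filled b C j)) (trans (eq j) (word-filled b D _))

  next : Core → Core
  next C with 2 + weight false C ≤? weight true C
  ... | yes gap = proj₁ (longestMatch C gap)
  ... | no _    = C

  next-match : ∀ C → 2 + weight false C ≤ weight true C → Σ (Match C (next C)) Longest
  next-match C gap with 2 + weight false C ≤? weight true C
  ... | yes gap′ = proj₂ (longestMatch C gap′)
  ... | no ¬gap  = contradiction gap ¬gap

  open Match

  match-lo : ∀ {C E} → Match C E → ∀ j → fill false (letter C j) ≤ᴮ fill false (letter E j)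
  match-lo {C} {E} M j with j ≋? u M | j ≋? g M + u M
  ... | yes at-u | _ rewrite periodic-≋ (letter-per C) at-u | flat-u M = Boolₚ.≤-minimum _
  ... | no _ | yes at-v rewrite periodic-≋ (letter-per C) at-v | flat-g+u M = Boolₚ.≤-minimum _
  ... | no j≋̸u | no j≋̸v = Boolₚ.≤-reflexive (cong (fill false) (sym (elsewhere M j j≋̸u j≋̸v)))

  match-hi : ∀ {C E} → Match C E → ∀ j → fill true (letter E j) ≤ᴮ fill true (letter C j)
  match-hi {C} {E} M j with j ≋? u M | j ≋? g M + u M
  ... | yes at-u | _ rewrite periodic-≋ (letter-per C) at-u | flat-u M = Boolₚ.≤-maximum _
  ... | no _ | yes at-v rewrite periodic-≋ (letter-per C) at-v | flat-g+u M = Boolₚ.≤-maximum _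
  ... | no j≋̸u | no j≋̸v = Boolₚ.≤-reflexive (cong (fill true) (elsewhere M j j≋̸u j≋̸v))

  fill-mono : ∀ l → fill false l ≤ᴮ fill true l
  fill-mono up   = Boolₚ.≤-refl
  fill-mono down = Boolₚ.≤-refl
  fill-mono flat = Boolₚ.≤-minimum true

  weights : ∀ C → 2 + size (filled false C) ≤ size (filled true C) →
            2 + weight false C ≤ weight true C
  weights C = subst₂ (λ x y → 2 + x ≤ y) (size-filled false C) (size-filled true C)

  -- A rotated longest match is again a longest match. Rotating `N` so that its result has the
  -- letters of `E` reduces the claim to equal letters, and the same rotation then relates `C` and
  -- `D`.
  match-injective-~ : ∀ {C E D F} (M : Match C E) (N : Match D F) → Longest M → Longest N →
                      filled false E ~ filled false F → filled false C ~ filled false D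
  match-injective-~ {C} {E} {D} {F} M N longest-M longest-N E~F with ~⇒letters false E F E~F
  ... | q , eq = letters⇒~ false C D q
    (match-injective M (shift-match (q * r) N) longest-M (shift-longest (q * r) N longest-N) eq)

  balanced : ∀ C → size (filled false C) ≡ size (filled true C) → filled false C ~ filled true C
  balanced C eq = agree⇒~ λ j →
    trans (word-filled false C j) (trans (nonflat j) (sym (word-filled true C j)))
    where
    nonflat : ∀ j → fill false (letter C j) ≡ fill true (letter C j)
    nonflat j with letter C j in eq′
    ... | up   = refl
    ... | down = refl
    ... | flat = contradiction (trans (sym (size-filled false C)) (trans eq (size-filled true C)))
                   (<⇒≢ (flat-weight C eq′))

  core : ∀ A → ∃ λ C → A ~ filled false C ⊎ A ~ filled true C
  core A with core-exists (word-per A)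
  ... | false , C , eq = C , inj₁ (agree⇒~ λ j → trans (sym (eq j)) (sym (word-filled false C j)))
  ... | true  , C , eq = C , inj₂ (agree⇒~ λ j → trans (sym (eq j)) (sym (word-filled true C j)))

  nestedPairs : NestedPairs graded
  nestedPairs = record
    { _≈?_     = _~?_
    ; points   = subsets n
    ; every    = λ A → Any.map (λ { refl → agree⇒~ (λ _ → refl) }) (∈-subsets A)
    ; Pair     = Core
    ; lo       = filled false
    ; hi       = filled true
    ; next     = next
    ; lo+hi    = λ C → trans (cong₂ _+_ (size-filled false C) (size-filled true C)) (weight-sum C)
    ; lo≤hi    = λ C →
        subst₂ _≤_ (sym (size-filled false C)) (sym (size-filled true C)) (weight-mono C)
    ; lo≲hi    = λ C → below-filled false true C C (λ j → fill-mono (letter C j))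
    ; balanced = balanced
    ; lo⋖next  = λ C gap → let M , _ = next-match C (weights C gap) in
        below-filled false false C (next C) (match-lo M) ,
        trans (size-filled false (next C))
          (trans (weight-false-match M) (cong suc (sym (size-filled false C))))
    ; next⋖hi  = λ C gap → let M , _ = next-match C (weights C gap) in
        below-filled true true (next C) C (match-hi M) ,
        trans (size-filled true C)
          (trans (weight-true-match M) (cong suc (sym (size-filled true (next C)))))
    ; next-injective = λ C D gap gap′ →
        let M , longest-M = next-match C (weights C gap)
            N , longest-N = next-match D (weights D gap′)
        in match-injective-~ M N longest-M longest-N
    ; lo⇒hi    = λ C D C~D → let q , eq = ~⇒letters false C D C~D in letters⇒~ true C D q eq
    ; hi⇒lo    = λ C D C~D → let q , eq = ~⇒letters true C D C~D in letters⇒~ false C D q eq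
    ; pair     = core
    }

  block-SCD : GradedPreorder.SCD graded
  block-SCD = Nested.nested-SCD graded nestedPairs

-- Disjoint cycles

module _ {n : ℕ} where
  open Block

  private
    module B (b : Block n) = BlockOrder b

  infix 4 _∈ᵇ_

  _∈ᵇ_ : Fin n → Block n → Set
  y ∈ᵇ b = ∃ λ j → point b j ≡ y

  _∈ᵇ?_ : ∀ y b → Dec (y ∈ᵇ b)
  y ∈ᵇ? b = map′ (λ eq → index b y , eq) from (point b (index b y) ≟ᶠ y)
    where
    open Cyclic (k′ b) using (periodic-%)
    from : y ∈ᵇ b → point b (index b y) ≡ y
    from (j , refl) =
      trans (cong (point b) (index-point b j)) (sym (periodic-% (point-per b) j))

  Apart : Block n → Block n → Set
  Apart b c = ∀ y → y ∈ᵇ b → ¬ y ∈ᵇ c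

  merge : Block n → Subset n → Subset n → Subset n
  merge b A B = tabulate λ y → lookupᵛ (if does (y ∈ᵇ? b) then A else B) y

  word-merge : ∀ b A B j → B.word b (merge b A B) j ≡ B.word b A j
  word-merge b A B j = trans (lookup∘tabulate _ (point b j)) (inside-b (point b j ∈ᵇ? b))
    where
    inside-b : (d : Dec (point b j ∈ᵇ b)) →
               lookupᵛ (if does d then A else B) (point b j) ≡ lookupᵛ A (point b j)
    inside-b (yes _) = refl
    inside-b (no ∉b) = contradiction (j , refl) ∉b

  word-merge-apart : ∀ {b c} → Apart b c → ∀ A B j → B.word c (merge b A B) j ≡ B.word c B j
  word-merge-apart {b} {c} b#c A B j =
    trans (lookup∘tabulate _ (point c j)) (outside-b (point c j ∈ᵇ? b))
    where
    outside-b : (d : Dec (point c j ∈ᵇ b)) →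
                lookupᵛ (if does d then A else B) (point c j) ≡ lookupᵛ B (point c j)
    outside-b (yes ∈b) = contradiction (j , refl) (b#c _ ∈b)
    outside-b (no _)   = refl

  blocksGraded : List (Block n) → GradedPreorder
  blocksGraded bs = record
    { preorder = record
      { Carrier    = Subset n
      ; _≈_        = λ A B → All (λ b → B._~_ b A B) bs
      ; _≲_        = λ A B → All (λ b → B._≲ᴮ_ b A B) bs
      ; isPreorder = record
        { isEquivalence = record
          { refl  = All.universal (λ b → B.agree⇒~ b (λ _ → refl)) bs
          ; sym   = All.map (λ {b} → B.~-sym b)
          ; trans = λ A~B B~C → All.zipWith (λ {b} (p , q) → B.~-trans b p q) (A~B , B~C)
          }
        ; reflexive = All.map (λ {b} → P.≲-reflexive b)
        ; trans     = λ A≲B B≲C → All.zipWith (λ {b} (p , q) → B.≲-trans b p q) (A≲B , B≲C)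
        }
      }
    ; rank      = λ A → sum (map (λ b → B.size b A) bs)
    ; top       = sum (map (suc ∘ k′) bs)
    ; rank-cong = rank-cong
    }
    where
    module P (b : Block n) = GradedPreorder (B.graded b)
    rank-cong : ∀ {A B bs} → All (λ b → B._~_ b A B) bs →
                sum (map (λ b → B.size b A) bs) ≡ sum (map (λ b → B.size b B) bs)
    rank-cong []           = refl
    rank-cong {bs = b ∷ _} (p ∷ ps) = cong₂ _+_ (B.size-cong b p) (rank-cong ps)

  blocks-SCD : ∀ {bs} → AllPairs Apart bs → GradedPreorder.SCD (blocksGraded bs)
  -- Without blocks all subsets are equivalent, so a single representative, here `⊥`, forms the only
  -- chain.
  blocks-SCD [] = [ [ ⊥ ] ] , (_ , _ , GradedPreorder.[-] , refl) ∷ [] , [] ∷ [] , λ _ → here []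
  blocks-SCD {b ∷ bs} (b# ∷ bs#) =
    map-SCD {P = B.graded b ×ᴳ blocksGraded bs} {Q = blocksGraded (b ∷ bs)}
      (λ (A , B) → merge b A B) mono rank-merge refl merge-cong injective
      (λ A → (A , A) , Q.Eq.sym (merge-self A))
      (×-SCD {P = B.graded b} {Q = blocksGraded bs} (B.block-SCD b) (blocks-SCD bs#))
    where
    module P = GradedPreorder (B.graded b)
    module Q′ = GradedPreorder (blocksGraded bs)
    module Q = GradedPreorder (blocksGraded (b ∷ bs))
    onˡ : ∀ A B → merge b A B P.≈ A
    onˡ A B = B.agree⇒~ b (word-merge b A B)
    onʳ : ∀ A B → merge b A B Q′.≈ B
    onʳ A B = All.map (λ {c} b#c → B.agree⇒~ c (word-merge-apart {b} {c} b#c A B)) b#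
    merge-self : ∀ A → merge b A A Q.≈ A
    merge-self A = onˡ A A ∷ onʳ A A
    mono : ∀ {x y} → (proj₁ x P.≲ proj₁ y) × (proj₂ x Q′.≲ proj₂ y) →
           merge b (proj₁ x) (proj₂ x) Q.≲ merge b (proj₁ y) (proj₂ y)
    mono (p , q) =
      P.≲-trans (P.≲-reflexive (onˡ _ _)) (P.≲-trans p (P.≲-reflexive (P.Eq.sym (onˡ _ _)))) ∷
      Q′.≲-trans (Q′.≲-reflexive (onʳ _ _)) (Q′.≲-trans q (Q′.≲-reflexive (Q′.Eq.sym (onʳ _ _))))
    merge-cong : ∀ {x y} → (proj₁ x P.≈ proj₁ y) × (proj₂ x Q′.≈ proj₂ y) →
                 merge b (proj₁ x) (proj₂ x) Q.≈ merge b (proj₁ y) (proj₂ y)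
    merge-cong (p , q) =
      P.Eq.trans (onˡ _ _) (P.Eq.trans p (P.Eq.sym (onˡ _ _))) ∷
      Q′.Eq.trans (onʳ _ _) (Q′.Eq.trans q (Q′.Eq.sym (onʳ _ _)))
    injective : ∀ {x y} → merge b (proj₁ x) (proj₂ x) Q.≈ merge b (proj₁ y) (proj₂ y) →
                (proj₁ x P.≈ proj₁ y) × (proj₂ x Q′.≈ proj₂ y)
    injective (p ∷ q) =
      P.Eq.trans (P.Eq.sym (onˡ _ _)) (P.Eq.trans p (onˡ _ _)) ,
      Q′.Eq.trans (Q′.Eq.sym (onʳ _ _)) (Q′.Eq.trans q (onʳ _ _))
    rank-merge : ∀ x → Q.rank (merge b (proj₁ x) (proj₂ x)) ≡ P.rank (proj₁ x) + Q′.rank (proj₂ x)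
    rank-merge (A , B) = cong₂ _+_ (P.rank-cong (onˡ A B)) (Q′.rank-cong (onʳ A B))

  points : Block n → List (Fin n)
  points b = applyUpTo (point b) (suc (k′ b))

  points-unique : ∀ b → Unique (points b)
  points-unique b = Uniqueₚ.applyUpTo⁺₁ (point b) (suc (k′ b)) λ i<j j<k eq → <⇒≢ i<j
    (small≋ (<-trans i<j j<k) j<k (residues
      (trans (sym (index-point b _)) (trans (cong (index b) eq) (index-point b _)))))
    where open Cyclic (k′ b)

  ∈-points⇒∈ᵇ : ∀ b {y} → y ∈ points b → y ∈ᵇ b
  ∈-points⇒∈ᵇ b y∈ with ∈-applyUpTo⁻ (point b) y∈
  ... | j , _ , eq = j , sym eq

  ∈ᵇ⇒∈-points : ∀ b {y} → y ∈ᵇ b → y ∈ points b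
  ∈ᵇ⇒∈-points b (j , refl) = subst (_∈ points b)
    (sym (Cyclic.periodic-% (k′ b) (point-per b) j))
    (∈-applyUpTo⁺ (point b) (m%n<n j (suc (k′ b))))

  blocks-partition : ∀ {bs} → AllPairs Apart bs → (∀ y → Any (y ∈ᵇ_) bs) →
                     concatMap points bs ↭ allFin n
  blocks-partition {bs} apart cover = ∼bag⇒↭ (unique∧set⇒bag
    (Uniqueₚ.concat⁺ (Allₚ.map⁺ (All.universal points-unique bs))
      (AllPairsₚ.map⁺ (AllPairs.map (λ {b} {c} → points-disjoint {b} {c}) apart)))
    (Uniqueₚ.allFin⁺ n)
    (mk⇔ (λ _ → ∈-allFin _) (λ _ → covered _)))
    where
    covered : ∀ y → y ∈ concatMap points bs
    covered y = ∈-concatMap⁺ points (Any.map (λ {b} → ∈ᵇ⇒∈-points b) (cover y))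
    points-disjoint : ∀ {b c} → Apart b c → Disjoint (setoid (Fin n)) (points b) (points c)
    points-disjoint {b} {c} b#c (y∈b , y∈c) = b#c _ (∈-points⇒∈ᵇ b y∈b) (∈-points⇒∈ᵇ c y∈c)

  blocks-rank : ∀ {bs} → AllPairs Apart bs → (∀ y → Any (y ∈ᵇ_) bs) →
                ∀ A → GradedPreorder.rank (blocksGraded bs) A ≡ ∣ A ∣
  blocks-rank {bs} apart cover A = begin
    sum (map (λ b → B.size b A) bs)       ≡⟨ by-block bs ⟩
    sum (map f (concatMap points bs))     ≡⟨ sum-↭ (↭-map⁺ f (blocks-partition apart cover)) ⟩
    sum (map f (allFin n))                ≡⟨ cong sum (map-tabulate id f) ⟩
    sum (tabulateˡ f)                     ≡⟨ count A ⟨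
    ∣ A ∣                                 ∎
    where
    open ≡-Reasoning
    f : Fin n → ℕ
    f y = indicator (lookupᵛ A y)
    by-block : ∀ bs → sum (map (λ b → B.size b A) bs) ≡ sum (map f (concatMap points bs))
    by-block []       = refl
    by-block (b ∷ bs) = begin
      B.size b A + sum (map (λ b → B.size b A) bs)
        ≡⟨ cong₂ _+_ (cong sum (sym (map-applyUpTo (point b) f (suc (k′ b))))) (by-block bs) ⟩
      sum (map f (points b)) + sum (map f (concatMap points bs))
        ≡⟨ sum-++ (map f (points b)) _ ⟨
      sum (map f (points b) ++ map f (concatMap points bs))
        ≡⟨ cong sum (map-++ f (points b) _) ⟨
      sum (map f (concatMap points (b ∷ bs))) ∎
    count : ∀ {m} (A : Subset m) → ∣ A ∣ ≡ sum (tabulateˡ (λ y → indicator (lookupᵛ A y)))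
    count []            = refl
    count (inside  ∷ A) = cong suc (count A)
    count (outside ∷ A) = count A

  blocks-top : ∀ {bs} → AllPairs Apart bs → (∀ y → Any (y ∈ᵇ_) bs) →
               GradedPreorder.top (blocksGraded bs) ≡ n
  blocks-top {bs} apart cover = begin
    sum (map (suc ∘ k′) bs)           ≡⟨ full bs ⟨
    sum (map (λ b → B.size b ⊤) bs)   ≡⟨ blocks-rank apart cover ⊤ ⟩
    ∣ ⊤ {n} ∣                         ≡⟨ ∣⊤∣≡n n ⟩
    n                                 ∎
    where
    open ≡-Reasoning
    ones : ∀ m → ∑ (λ _ → 1) m ≡ m
    ones zero    = refl
    ones (suc m) = cong suc (ones m)
    full : ∀ bs → sum (map (λ b → B.size b ⊤) bs) ≡ sum (map (suc ∘ k′) bs)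
    full []       = refl
    full (b ∷ bs) = cong₂ _+_ (trans
      (∑-cong (suc (k′ b)) (λ {i} _ → cong indicator (lookup-replicate (point b i) inside)))
      (ones (suc (k′ b)))) (full bs)

-- The quotient of the Boolean lattice

last-∷ : ∀ {a} {A : Set a} (x y : A) ys → last (x ∷⁺ (y ∷ ys)) ≡ last (y ∷⁺ ys)
last-∷ x y ys with initLast ys
... | []       = refl
... | _ ∷ʳ′ _ = refl

⊆-step : ∀ {n} {A B : Subset n} → A ⊆ B → ∣ A ∣ < ∣ B ∣ →
         ∃ λ C → A ⊆ C × C ⊆ B × ∣ C ∣ ≡ suc ∣ A ∣
⊆-step {A = []} {[]} _ ()
⊆-step {A = outside ∷ A} {inside ∷ B} A⊆B _ =
  inside ∷ A , out⊆ ⊆-refl , s⊆s (drop-∷-⊆ A⊆B) , refl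
⊆-step {A = inside ∷ A} {outside ∷ B} A⊆B _ with () ← A⊆B Vec.here
⊆-step {A = inside ∷ A} {inside ∷ B} A⊆B lt
  with C , A⊆C , C⊆B , eq ← ⊆-step (drop-∷-⊆ A⊆B) (s≤s⁻¹ lt) =
  inside ∷ C , s⊆s A⊆C , s⊆s C⊆B , cong suc eq
⊆-step {A = outside ∷ A} {outside ∷ B} A⊆B lt
  with C , A⊆C , C⊆B , eq ← ⊆-step (drop-∷-⊆ A⊆B) lt =
  outside ∷ C , s⊆s A⊆C , s⊆s C⊆B , eq

allPairs-++⁻ʳ : ∀ {a r} {A : Set a} {R : A → A → Set r} xs {ys} →
                AllPairs R (xs ++ ys) → AllPairs R ys
allPairs-++⁻ʳ []       rs       = rs
allPairs-++⁻ʳ (x ∷ xs) (_ ∷ rs) = allPairs-++⁻ʳ xs rs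

allPairs-++⁻-cross : ∀ {a r} {A : Set a} {R : A → A → Set r} xs {ys} →
                     AllPairs R (xs ++ ys) → All (λ x → All (R x) ys) xs
allPairs-++⁻-cross []       _        = []
allPairs-++⁻-cross (x ∷ xs) (r ∷ rs) = Allₚ.++⁻ʳ xs r ∷ allPairs-++⁻-cross xs rs

module _ {n : ℕ} {p : Level} (G : Subgroup (SymmetricGroup n) p) where
  open Subgroup G using (Member; ε-closed; ∙-closed)
  open Poset (BooleanQuotient G) using (module Eq)

  private
    Q : Poset 0ℓ p p
    Q = BooleanQuotient G
    _⋖Q_ = _⋖_ Q
    _∼_ : Subset n → Subset n → Set p
    A ∼ B = _∈[_] G B A

  strict⇒<∣∣ : ∀ {A B} → _≤ᴼ_ G A B → ¬ A ∼ B → ∣ A ∣ < ∣ B ∣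
  strict⇒<∣∣ A≤B@(X , Y , X∈A , Y∈B , X⊆Y) A≁B = ≰⇒> λ ∣B∣≤∣A∣ →
    A≁B (orbit-trans G X∈A (subst (λ Z → _∈[_] G _ Z)
      (sym (⊆∧∣∣≥⇒≡ X⊆Y (subst₂ _≤_ (sym (orbit-∣∣ G Y∈B)) (sym (orbit-∣∣ G X∈A)) ∣B∣≤∣A∣)))
      (orbit-sym G Y∈B)))

  ∣∣≢⇒≁ : ∀ {A B} → ∣ B ∣ ≢ ∣ A ∣ → ¬ A ∼ B
  ∣∣≢⇒≁ neq A∼B = neq (orbit-∣∣ G A∼B)

  -- If the representatives `X ⊆ Y` differed by two or more elements, a set of size one more than
  -- `X` would fit between them. Size is constant on orbits, so its orbit would lie strictly between
  -- the two.
  ⋖⇒∣∣ : ∀ {A B} → A ⋖Q B → ∣ B ∣ ≡ suc ∣ A ∣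
  ⋖⇒∣∣ {A} {B} ((A≤B@(X , Y , X∈A , Y∈B , X⊆Y) , A≁B) , nothing-between) =
    by-size (m≤n⇒m<n∨m≡n (strict⇒<∣∣ A≤B A≁B))
    where
    by-size : suc ∣ A ∣ < ∣ B ∣ ⊎ suc ∣ A ∣ ≡ ∣ B ∣ → ∣ B ∣ ≡ suc ∣ A ∣
    by-size (inj₂ eq) = sym eq
    by-size (inj₁ lt) with ⊆-step X⊆Y
      (subst₂ _<_ (sym (orbit-∣∣ G X∈A)) (sym (orbit-∣∣ G Y∈B)) (<-trans (n<1+n _) lt))
    ... | Z , X⊆Z , Z⊆Y , ∣Z∣≡ = ⊥-elim (nothing-between Z
      ( ((X , Z , X∈A , orbit-refl G , X⊆Z) , ∣∣≢⇒≁ (λ eq → 1+n≢n (trans (sym ∣Z∣≡1+∣A∣) eq)))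
      , ((Z , Y , orbit-refl G , Y∈B , Z⊆Y) , ∣∣≢⇒≁ (λ eq → <⇒≢ lt (trans (sym ∣Z∣≡1+∣A∣) (sym eq))))))
      where
      ∣Z∣≡1+∣A∣ : ∣ Z ∣ ≡ suc ∣ A ∣
      ∣Z∣≡1+∣A∣ = trans ∣Z∣≡ (cong suc (orbit-∣∣ G X∈A))

  ∣∣⇒⋖ : ∀ {A B} → _≤ᴼ_ G A B → ∣ B ∣ ≡ suc ∣ A ∣ → A ⋖Q B
  ∣∣⇒⋖ {A} {B} A≤B eq = (A≤B , ∣∣≢⇒≁ (λ eq′ → 1+n≢n (trans (sym eq) eq′))) ,
    λ C ((A≤C , A≁C) , (C≤B , C≁B)) →
      <⇒≱ (strict⇒<∣∣ A≤C A≁C) (s≤s⁻¹ (subst (∣ C ∣ <_) eq (strict⇒<∣∣ C≤B C≁B)))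

  saturated-length : ∀ A As → Linked _⋖Q_ (A ∷ As) → length As + ∣ A ∣ ≡ ∣ last (A ∷⁺ As) ∣
  saturated-length A []        _            = refl
  saturated-length A (B ∷ As) (A⋖B ∷ ch) = begin
    suc (length As) + ∣ A ∣     ≡⟨ +-suc (length As) ∣ A ∣ ⟨
    length As + suc ∣ A ∣       ≡⟨ cong (length As +_) (⋖⇒∣∣ A⋖B) ⟨
    length As + ∣ B ∣           ≡⟨ saturated-length B As ch ⟩
    ∣ last (B ∷⁺ As) ∣          ≡⟨ cong ∣_∣ (last-∷ A B As) ⟨
    ∣ last (A ∷⁺ (B ∷ As)) ∣    ∎
    where open ≡-Reasoning

  quotient-ranked : Ranked Q
  quotient-ranked = record
    { elements     = subsets n
    ; finite       = λ A → Any.map (λ { refl → orbit-refl G }) (∈-subsets A)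
    ; bottom       = ⊥
    ; minimum      = λ A → ⊥ , A , orbit-refl G , orbit-refl G , ⊥⊆
    ; rank         = ∣_∣
    ; chain-length = λ { {A} (B ∷⁺ Bs) ch B≈⊥ last≈A → begin
        length Bs              ≡⟨ +-identityʳ _ ⟨
        length Bs + 0          ≡⟨ cong (length Bs +_) (trans (orbit-∣∣ G (orbit-sym G B≈⊥)) (∣⊥∣≡0 n)) ⟨
        length Bs + ∣ B ∣      ≡⟨ saturated-length B Bs ch ⟩
        ∣ last (B ∷⁺ Bs) ∣     ≡⟨ orbit-∣∣ G last≈A ⟨
        ∣ A ∣                  ∎ }
    }
    where open ≡-Reasoning

  totalRank≡n : Ranked.totalRank quotient-ranked ≡ n
  totalRank≡n = ≤-antisym
    (max≤v⁺ z≤n (Allₚ.map⁺ (All.universal ∣p∣≤n (subsets n))))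
    (v≤max⁺ 0 _ (inj₂ (Any.map ≤-reflexive
      (subst (_∈ map ∣_∣ (subsets n)) (∣⊤∣≡n n) (∈-map⁺ ∣_∣ (∈-subsets ⊤))))))

  module _ (P : GradedPreorder) where

    private
      module P = GradedPreorder P

    module _ (f : P.Carrier → Subset n)
      (mono : ∀ {x y} → x P.≲ y → _≤ᴼ_ G (f x) (f y))
      (f-cong : ∀ {x y} → x P.≈ y → f x ∼ f y)
      (injective : ∀ {x y} → f x ∼ f y → x P.≈ y)
      (surjective : ∀ A → ∃ λ x → A ∼ f x)
      (rank-f : ∀ x → ∣ f x ∣ ≡ P.rank x)
      (top-f : P.top ≡ n) where

      toChain : ∀ {x y xs} → P.Saturated x y xs →
        ∃ λ C → toList C ≡ map f xs × List⁺.head C ≡ f x × last C ≡ f y × IsSaturated Q C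
      toChain {x} P.[-] = f x ∷⁺ [] , refl , refl , refl , [-]
      toChain {x} ((x≲y , eq) P.∷ ch) with toChain ch
      ... | B ∷⁺ Bs , C≡ , head≡ , last≡ , sat =
        f x ∷⁺ (B ∷ Bs) , cong (f x ∷_) C≡ , refl , trans (last-∷ (f x) B Bs) last≡ ,
        subst (f x ⋖Q_) (sym head≡)
          (∣∣⇒⋖ (mono x≲y) (trans (rank-f _) (trans eq (cong suc (sym (rank-f x)))))) ∷ sat

      toChains : ∀ {css} → All P.Symmetric css →
        ∃ λ Cs → map toList Cs ≡ map (map f) css × All (Ranked.IsSymmetric quotient-ranked) Cs
      toChains [] = [] , refl , []
      toChains ((x , y , ch , eq) ∷ sym-css) with toChain ch | toChains sym-css
      ... | C , C≡ , head≡ , last≡ , sat | Cs , Cs≡ , sym-Cs =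
        C ∷ Cs , cong₂ _∷_ C≡ Cs≡ ,
        (sat , (begin
          ∣ List⁺.head C ∣ + ∣ last C ∣       ≡⟨ cong₂ (λ A B → ∣ A ∣ + ∣ B ∣) head≡ last≡ ⟩
          ∣ f x ∣ + ∣ f y ∣                   ≡⟨ cong₂ _+_ (rank-f x) (rank-f y) ⟩
          P.rank x + P.rank y                 ≡⟨ trans eq (trans top-f (sym totalRank≡n)) ⟩
          Ranked.totalRank quotient-ranked    ∎)) ∷ sym-Cs
        where open ≡-Reasoning

      chains-disjoint : ∀ css → SetoidUnique.Unique P.Eq.setoid (concat css) →
        AllPairs (λ xs ys → Disjoint Eq.setoid (map f xs) (map f ys)) css
      chains-disjoint []         _      = []
      chains-disjoint (xs ∷ css) unique =
        All.tabulate disjoint ∷ chains-disjoint css (allPairs-++⁻ʳ xs unique)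
        where
        cross = allPairs-++⁻-cross xs unique
        disjoint : ∀ {ys} → ys ∈ css → Disjoint Eq.setoid (map f xs) (map f ys)
        disjoint ys∈ (A∈xs , A∈ys)
          with x , x∈ , A∼fx ← find (Anyₚ.map⁻ A∈xs)
             | y , y∈ , A∼fy ← find (Anyₚ.map⁻ A∈ys) =
          All.lookup (All.lookup cross x∈) (∈-concat⁺′ y∈ ys∈)
            (injective (orbit-trans G (orbit-sym G A∼fx) A∼fy))

      transfer : P.SCD → SymmetricChainOrder Q
      transfer (css , sym-css , unique , complete) = quotient-ranked , record
        { chains    = Cs
        ; symmetric = sym-Cs
        ; covering  = λ A → Anyₚ.map⁻ (subst (Any (Any (A ∼_))) (sym Cs≡)
            (Anyₚ.map⁺ (Any.map Anyₚ.map⁺ (Anyₚ.concat⁻ css (covered A)))))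
        ; disjoint  = AllPairsₚ.map⁻ (subst (AllPairs (Disjoint Eq.setoid)) (sym Cs≡)
            (AllPairsₚ.map⁺ (chains-disjoint css unique)))
        }
        where
        Cs≡′ = toChains sym-css
        Cs = proj₁ Cs≡′
        Cs≡ = proj₁ (proj₂ Cs≡′)
        sym-Cs = proj₂ (proj₂ Cs≡′)
        covered : ∀ A → Any (λ x → A ∼ f x) (concat css)
        covered A with x , A∼fx ← surjective A =
          Any.map (λ x≈y → orbit-trans G A∼fx (f-cong x≈y)) (complete x)

-- Groups acting by independent rotations of blocks

module _ {n : ℕ} {p : Level} (G : Subgroup (SymmetricGroup n) p) where
  open Subgroup G using (Member; ε-closed; ∙-closed)
  open Block
  open BlockOrder using (word; turn)

  TurnsBy : Block n → ℕ → Permutation′ n → Set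
  TurnsBy b q g = ∀ j → g ⟨$⟩ʳ point b j ≡ point b (j + q * r b)

  record Rotation (b : Block n) : Set p where
    field
      generator : Permutation′ n
      member    : Member generator
      rotates   : ∀ j → generator ⟨$⟩ʳ point b j ≡ point b (j + r b)
      fixes     : ∀ y → ¬ y ∈ᵇ b → generator ⟨$⟩ʳ y ≡ y

  rotation-power : ∀ {b} → Rotation b → ∀ q →
    ∃ λ g → Member g × TurnsBy b q g × (∀ y → ¬ y ∈ᵇ b → g ⟨$⟩ʳ y ≡ y)
  rotation-power {b} R zero =
    Perm.id , ε-closed , (λ j → cong (point b) (sym (+-identityʳ j))) , λ _ _ → refl
  rotation-power {b} R (suc q) with rotation-power R q
  ... | g , g∈G , turns , fixes-g = g ∘ₚ generator , ∙-closed member g∈G ,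
    (λ j → trans (cong (generator ⟨$⟩ʳ_) (turns j)) (trans (rotates _)
      (cong (point b) (trans (+-assoc j (q * r b) (r b)) (cong (j +_) (+-comm (q * r b) (r b))))))) ,
    λ y y∉b → trans (cong (generator ⟨$⟩ʳ_) (fixes-g y y∉b)) (fixes y y∉b)
    where open Rotation R

  -- Each rotation fixes everything off its block, so powers chosen separately for the blocks
  -- compose to one element of G that performs them all. `T` carries along the property for which
  -- each exponent was chosen.
  combine : ∀ {bs} {T : Block n → ℕ → Set} → AllPairs Apart bs → All Rotation bs →
    All (λ b → ∃ (T b)) bs →
    ∃ λ g → Member g × All (λ b → ∃ λ q → T b q × TurnsBy b q g) bs ×
      (∀ y → All (λ b → ¬ y ∈ᵇ b) bs → g ⟨$⟩ʳ y ≡ y)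
  combine [] [] [] = Perm.id , ε-closed , [] , λ _ _ → refl
  combine {b ∷ bs} {T} (b# ∷ apart) (R ∷ Rs) ((q , Tq) ∷ Ts)
    with combine apart Rs Ts | rotation-power R q
  ... | g , g∈G , turns , fixes-g | h , h∈G , turns-h , fixes-h =
    g ∘ₚ h , ∙-closed h∈G g∈G ,
    (q , Tq , λ j → trans
      (cong (h ⟨$⟩ʳ_) (fixes-g _ (All.map (λ b#c → b#c _ (j , refl)) b#))) (turns-h j)) ∷
    All.zipWith (λ (b#c , q , Tq , turns) → q , Tq , λ j → trans
      (cong (h ⟨$⟩ʳ_) (turns j)) (fixes-h _ (λ ∈b → b#c _ ∈b (_ , refl)))) (b# , turns) ,
    λ { y (y∉b ∷ y∉bs) → trans (cong (h ⟨$⟩ʳ_) (fixes-g y y∉bs)) (fixes-h y y∉b) }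

  module _ {bs : List (Block n)} (apart : AllPairs Apart bs) (cover : ∀ y → Any (y ∈ᵇ_) bs)
    (rotations : All Rotation bs)
    (turns : ∀ {g} → Member g → All (λ b → ∃ λ q → TurnsBy b q g) bs) where

    private
      module P = GradedPreorder (blocksGraded bs)

    orbit⇒≈ : ∀ {A B} → _∈[_] G B A → A P.≈ B
    orbit⇒≈ {A} (moved-by g g∈G refl) = All.map (λ {b} (q , turns-b) → turn q λ j → begin
      lookupᵛ A (point b j)                                 ≡⟨ cong (lookupᵛ A) (inverseˡ g) ⟨
      lookupᵛ A (g ⟨$⟩ˡ (g ⟨$⟩ʳ point b j))                 ≡⟨ lookup∘tabulate _ (g ⟨$⟩ʳ point b j) ⟨
      lookupᵛ (image g A) (g ⟨$⟩ʳ point b j)                ≡⟨ cong (lookupᵛ (image g A)) (turns-b j) ⟩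
      lookupᵛ (image g A) (point b (j + q * r b))           ∎) (turns g∈G)
      where open ≡-Reasoning

    -- With R as equality this turns blockwise equivalence into equality of orbits; with R as the
    -- order of `Bool` it turns blockwise comparison into inclusion of representatives.
    realise : (_R_ : Bool → Bool → Set) → ∀ {A B} →
      All (λ b → ∃ λ q → ∀ j → word b A j R word b B (j + q * r b)) bs →
      ∃ λ g → Member g × (∀ y → lookupᵛ (image g A) y R lookupᵛ B y)
    realise _R_ {A} {B} agree with combine apart rotations agree
    ... | g , g∈G , turned , _ = g , g∈G , λ y →
      subst₂ _R_ (sym (lookup∘tabulate _ y)) (cong (lookupᵛ B) (inverseʳ g))
        (at (g ⟨$⟩ˡ y) turned (cover (g ⟨$⟩ˡ y)))
      where
      at : ∀ x {bs} → All (λ b → ∃ λ q → (∀ j → word b A j R word b B (j + q * r b)) × TurnsBy b q g) bs →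
           Any (x ∈ᵇ_) bs → lookupᵛ A x R lookupᵛ B (g ⟨$⟩ʳ x)
      at x ((q , agrees , turns-b) ∷ _) (here (j , refl)) =
        subst (λ z → lookupᵛ A x R lookupᵛ B z) (sym (turns-b j)) (agrees j)
      at x (_ ∷ all) (there x∈) = at x all x∈

    ≈⇒orbit : ∀ {A B} → A P.≈ B → _∈[_] G B A
    ≈⇒orbit {A} {B} A≈B
      with g , g∈G , eq ← realise _≡_ {A} {B} (All.map (λ { (turn q eq) → q , eq }) A≈B) =
      moved-by g g∈G (begin
        image g A                            ≡⟨ tabulate∘lookup (image g A) ⟨
        tabulate (lookupᵛ (image g A))       ≡⟨ tabulate-cong eq ⟩
        tabulate (lookupᵛ B)                 ≡⟨ tabulate∘lookup B ⟩
        B                                    ∎)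
      where open ≡-Reasoning

    ≲⇒≤ᴼ : ∀ {A B} → A P.≲ B → _≤ᴼ_ G A B
    ≲⇒≤ᴼ {A} {B} A≲B
      with g , g∈G , le ← realise _≤ᴮ_ {A} {B} (All.map (λ { (turn q le) → q , le }) A≲B) =
      image g A , B , moved-by g g∈G refl , orbit-refl G ,
      λ {y} y∈ → lookup⇒[]= y B (top (subst (_≤ᴮ lookupᵛ B y) ([]=⇒lookup y∈) (le y)))
      where
      top : ∀ {x} → true ≤ᴮ x → x ≡ true
      top _≤ᴮ_.b≤b = refl

    blocks-SCO : SymmetricChainOrder (BooleanQuotient G)
    blocks-SCO = transfer G (blocksGraded bs) id ≲⇒≤ᴼ ≈⇒orbit orbit⇒≈
      (λ A → A , orbit-refl G) (λ A → sym (blocks-rank apart cover A)) (blocks-top apart cover)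
      (blocks-SCD apart)

-- The blocks of a family of disjoint cycles

module _ {n : ℕ} where
  open Block

  fixed-block : Fin n → Block n
  fixed-block y = record
    { k′ = 0 ; r = 0 ; point = λ _ → y ; index = λ _ → 0
    ; point-per = λ _ → refl ; index-point = λ j → sym (n%1≡0 j) }

  iterate : Permutation′ n → Fin n → ℕ → Fin n
  iterate σ a zero    = a
  iterate σ a (suc j) = σ ⟨$⟩ʳ iterate σ a j

  -- For a list that closes up at `a`, the second component is the periodicity of the iterates.
  linked-iterate : ∀ σ a i {z} x xs → x ≡ iterate σ a i →
    Linked (λ x y → σ ⟨$⟩ʳ x ≡ y) ((x ∷ xs) ∷ʳ z) →
    (∀ j → lookup (x ∷ xs) j ≡ iterate σ a (toℕ j + i)) × iterate σ a (suc (length xs) + i) ≡ z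
  linked-iterate σ a i x [] x≡ (σx≡z ∷ [-]) =
    (λ { zero → x≡ }) , trans (cong (σ ⟨$⟩ʳ_) (sym x≡)) σx≡z
  linked-iterate σ a i x (y ∷ ys) x≡ (σx≡y ∷ linked)
    with lookups , end ← linked-iterate σ a (suc i) y ys
           (trans (sym σx≡y) (cong (σ ⟨$⟩ʳ_) x≡)) linked =
    (λ { zero → x≡ ; (suc j) → trans (lookups j) (cong (iterate σ a) (+-suc (toℕ j) i)) }) ,
    trans (cong (iterate σ a) (sym (+-suc (suc (length ys)) i))) end

  module Cycle (σ : Permutation′ n) (a : Fin n) (as : List (Fin n))
    (unique : Unique (a ∷ as)) (linked : Linked (λ x y → σ ⟨$⟩ʳ x ≡ y) ((a ∷ as) ∷ʳ a))
    (fixed : ∀ x → ¬ x ∈ (a ∷ as) → σ ⟨$⟩ʳ x ≡ x) where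

    c′ : ℕ
    c′ = length as

    open Cyclic c′ using (k; Periodic; periodic-%)

    σ^ : ℕ → Fin n
    σ^ = iterate σ a

    lookup-σ^ : ∀ j → lookup (a ∷ as) j ≡ σ^ (toℕ j)
    lookup-σ^ j = trans (proj₁ (linked-iterate σ a 0 a as refl linked) j)
      (cong σ^ (+-identityʳ (toℕ j)))

    σ^-per : Periodic σ^
    σ^-per zero    = trans (cong σ^ (sym (+-identityʳ k))) (proj₂ (linked-iterate σ a 0 a as refl linked))
    σ^-per (suc j) = cong (σ ⟨$⟩ʳ_) (σ^-per j)

    listed? : ∀ y → Dec (y ∈ (a ∷ as))
    listed? y = _∈?_ _≟ᶠ_ y (a ∷ as)

    position : ∀ y → Dec (y ∈ (a ∷ as)) → ℕ
    position y (yes y∈) = toℕ (Any.index y∈)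
    -- Any value will do off the cycle, since `index-point` constrains only points of the block.
    position y (no _)   = 0

    lookup-% : ∀ j → lookup (a ∷ as) (fromℕ< (m%n<n j k)) ≡ σ^ j
    lookup-% j = trans (lookup-σ^ (fromℕ< (m%n<n j k))) (trans (cong σ^ (toℕ-fromℕ< (m%n<n j k))) (sym (periodic-% σ^-per j)))

    σ^∈ : ∀ j → σ^ j ∈ (a ∷ as)
    σ^∈ j = subst (_∈ (a ∷ as)) (lookup-% j) (∈-lookup (fromℕ< (m%n<n j k)))

    ∈⇒σ^ : ∀ {y} → y ∈ (a ∷ as) → ∃ λ j → σ^ j ≡ y
    ∈⇒σ^ y∈ = toℕ (Any.index y∈) , trans (sym (lookup-σ^ (Any.index y∈))) (sym (Anyₚ.lookup-index y∈))

    position-σ^ : ∀ j d → position (σ^ j) d ≡ j % k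
    position-σ^ j (no ∉)  = contradiction (σ^∈ j) ∉
    position-σ^ j (yes ∈) = trans
      (cong toℕ (unique-lookup (setoid (Fin n)) unique (Any.index ∈) (fromℕ< (m%n<n j k))
        (trans (sym (Anyₚ.lookup-index ∈)) (sym (lookup-% j)))))
      (toℕ-fromℕ< (m%n<n j k))

    -- σ⁻ᵐ moves a point of the cycle forward by m (k − 1) steps.
    steps : ℤ → ℕ
    steps (pos m)    = m
    steps -[1+ m ] = suc m * c′

    cycle-block : ℤ → Block n
    cycle-block r = record
      { k′ = c′ ; r = steps r ; point = σ^ ; index = λ y → position y (listed? y)
      ; point-per = σ^-per ; index-point = λ j → position-σ^ j (listed? (σ^ j)) }

    times-σ^ : ∀ m j → times (Group.rawMonoid (SymmetricGroup n)) m σ ⟨$⟩ʳ σ^ j ≡ σ^ (j + m)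
    times-σ^ zero    j = cong σ^ (sym (+-identityʳ j))
    times-σ^ (suc m) j = trans (cong (σ ⟨$⟩ʳ_) (times-σ^ m j)) (cong σ^ (sym (+-suc j m)))

    power-σ^ : ∀ r j → power (SymmetricGroup n) σ r ⟨$⟩ʳ σ^ j ≡ σ^ (j + steps r)
    power-σ^ (pos m)    j = times-σ^ m j
    power-σ^ -[1+ m ] j = begin
      τ ⟨$⟩ˡ σ^ j                                   ≡⟨ cong (τ ⟨$⟩ˡ_) (Cyclic.periodic-≋ c′ σ^-per (Cyclic.+sk′+s-≋ c′ j (suc m))) ⟨
      τ ⟨$⟩ˡ σ^ (j + suc m * c′ + suc m)            ≡⟨ cong (τ ⟨$⟩ˡ_) (times-σ^ (suc m) (j + suc m * c′)) ⟨
      τ ⟨$⟩ˡ (τ ⟨$⟩ʳ σ^ (j + suc m * c′))           ≡⟨ inverseˡ τ ⟩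
      σ^ (j + suc m * c′)                           ∎
      where
      open ≡-Reasoning
      τ : Permutation′ n
      τ = times (Group.rawMonoid (SymmetricGroup n)) (suc m) σ

    moved⇒∈ : ∀ {y} → σ ⟨$⟩ʳ y ≢ y → ∃ λ j → σ^ j ≡ y
    moved⇒∈ {y} moved with listed? y
    ... | yes y∈ = ∈⇒σ^ y∈
    ... | no y∉  = contradiction (fixed y y∉) moved

    -- By injectivity of σ, a fixed iterate could be pulled back to a fixed `a`. So a nontrivial
    -- cycle moves all of its points, which makes disjointness of the permutations disjointness of
    -- the blocks.
    σ^-moved : σ ⟨$⟩ʳ a ≢ a → ∀ j → σ ⟨$⟩ʳ σ^ j ≢ σ^ j
    σ^-moved moved zero    eq = moved eq
    σ^-moved moved (suc j) eq = σ^-moved moved j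
      (trans (sym (inverseˡ σ)) (trans (cong (σ ⟨$⟩ˡ_) eq) (inverseˡ σ)))

    moved⇒a-moved : ∀ {y} → σ ⟨$⟩ʳ y ≢ y → σ ⟨$⟩ʳ a ≢ a
    moved⇒a-moved moved σa≡a with moved⇒∈ moved
    ... | j , refl = moved (trans (constant (suc j)) (sym (constant j)))
      where
      constant : ∀ j → σ^ j ≡ a
      constant zero    = refl
      constant (suc j) = trans (cong (σ ⟨$⟩ʳ_) (constant j)) σa≡a

  power-fixes : ∀ (σ : Permutation′ n) r {y} → σ ⟨$⟩ʳ y ≡ y → power (SymmetricGroup n) σ r ⟨$⟩ʳ y ≡ y
  power-fixes σ r {y} σy≡y = by-sign r
    where
    times-fixes : ∀ m → times (Group.rawMonoid (SymmetricGroup n)) m σ ⟨$⟩ʳ y ≡ y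
    times-fixes zero    = refl
    times-fixes (suc m) = trans (cong (σ ⟨$⟩ʳ_) (times-fixes m)) σy≡y
    by-sign : ∀ r → power (SymmetricGroup n) σ r ⟨$⟩ʳ y ≡ y
    by-sign (pos m)    = times-fixes m
    by-sign -[1+ m ] = trans (cong (τ ⟨$⟩ˡ_) (sym (times-fixes (suc m)))) (inverseˡ τ)
      where τ = times (Group.rawMonoid (SymmetricGroup n)) (suc m) σ

  module _ {p : Level} (G : Subgroup (SymmetricGroup n) p) where

    turns-generated : ∀ {i} {I : Set i} {gens : I → Permutation′ n} b →
      (∀ i → ∃ λ q → TurnsBy G b q (gens i)) →
      ∀ {g} → ⟨_⟩ (SymmetricGroup n) gens g → ∃ λ q → TurnsBy G b q g
    turns-generated b turns (gen i)  = turns i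
    turns-generated b turns unit     = 0 , λ j → cong (point b) (sym (+-identityʳ j))
    turns-generated b turns (mul {x} {y} x∈ y∈)
      with turns-generated b turns x∈ | turns-generated b turns y∈
    ... | q , turns-x | q′ , turns-y = q′ + q , λ j → trans (cong (x ⟨$⟩ʳ_) (turns-y j))
      (trans (turns-x _) (cong (point b) (BlockOrder.turn-turn b j q′ q)))
    -- As k′ is -1 modulo the length of the block, q times k′ turns undo q turns.
    turns-generated b turns (inv {x} x∈) with turns-generated b turns x∈
    ... | q , turns-x = q * k′ b , λ j → trans (cong (x ⟨$⟩ˡ_) (sym (back j))) (inverseˡ x)
      where
      open Cyclic (k′ b)
      back : ∀ j → x ⟨$⟩ʳ point b (j + q * k′ b * r b) ≡ point b j
      back j = trans (turns-x _) (periodic-≋ (point-per b) (≋-trans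
        (≡⇒≋ (cong (λ s → j + s + q * r b)
          (trans (*-assoc q (k′ b) (r b)) (trans (cong (q *_) (*-comm (k′ b) (r b))) (sym (*-assoc q (r b) (k′ b)))))))
        (+sk′+s-≋ j (q * r b))))
    turns-generated b turns (resp x≈y x∈) with turns-generated b turns x∈
    ... | q , turns-x = q , λ j → trans (sym (x≈y _)) (turns-x j)

  module CycleBlocks {p : Level} (G : Subgroup (SymmetricGroup n) p)
    (t : ℕ) (σ : Fin t → Permutation′ n) (r : Fin t → ℤ)
    (cycle : ∀ i → IsCycle (σ i))
    (disjoint : ∀ i j → i ≢ j → DisjointPermutations (σ i) (σ j))
    (generated : GeneratedBy (SymmetricGroup n) G (λ i → power (SymmetricGroup n) (σ i) (r i))) where
    open Subgroup G using (Member; ε-closed)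

    a : Fin t → Fin n
    a i = proj₁ (cycle i)

    module C (i : Fin t) = Cycle (σ i) (a i) (proj₁ (proj₂ (cycle i)))
      (proj₁ (proj₂ (proj₂ (cycle i)))) (proj₁ (proj₂ (proj₂ (proj₂ (cycle i)))))
      (proj₂ (proj₂ (proj₂ (proj₂ (cycle i)))))

    block : Fin t → Block n
    block i = C.cycle-block i (r i)

    -- A cycle of length one is the identity, and its listed point may lie on another cycle without
    -- violating disjointness. So only nontrivial cycles supply blocks of their own, and the points
    -- fixed by every `σ i` are added as blocks of length one.
    Nontrivial : Fin t → Set
    Nontrivial i = σ i ⟨$⟩ʳ a i ≢ a i

    nontrivial? : ∀ i → Dec (Nontrivial i)
    nontrivial? i = ¬? (σ i ⟨$⟩ʳ a i ≟ᶠ a i)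

    Fixed : Fin n → Set
    Fixed y = ∀ i → σ i ⟨$⟩ʳ y ≡ y

    fixed? : ∀ y → Dec (Fixed y)
    fixed? y = all? (λ i → σ i ⟨$⟩ʳ y ≟ᶠ y)

    cycles : List (Fin t)
    cycles = filter nontrivial? (allFin t)

    fixedPoints : List (Fin n)
    fixedPoints = filter fixed? (allFin n)

    blocks : List (Block n)
    blocks = map block cycles ++ map fixed-block fixedPoints

    block-moved : ∀ {i y} → Nontrivial i → y ∈ᵇ block i → σ i ⟨$⟩ʳ y ≢ y
    block-moved {i} nontrivial (j , refl) = C.σ^-moved i nontrivial j

    other-fixes : ∀ {i j y} → i ≢ j → Nontrivial i → y ∈ᵇ block i → σ j ⟨$⟩ʳ y ≡ y
    other-fixes {i} {j} {y} i≢j nontrivial y∈ with disjoint i j i≢j y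
    ... | inj₁ fixed = contradiction fixed (block-moved nontrivial y∈)
    ... | inj₂ fixed = fixed

    apart : AllPairs Apart blocks
    apart = AllPairsₚ.++⁺
      (AllPairsₚ.map⁺ (allPairs-given (Allₚ.all-filter nontrivial? (allFin t))
        (AllPairs.map (λ i≢j ¬i ¬j y y∈i y∈j → block-moved ¬j y∈j (other-fixes i≢j ¬i y∈i))
          (Uniqueₚ.filter⁺ nontrivial? (Uniqueₚ.allFin⁺ t)))))
      (AllPairsₚ.map⁺ (AllPairs.map (λ { x≢y _ (_ , refl) (_ , x≡y) → x≢y (sym x≡y) })
        (Uniqueₚ.filter⁺ fixed? (Uniqueₚ.allFin⁺ n))))
      (Allₚ.map⁺ (All.map (λ {i} ¬i → Allₚ.map⁺ (All.map
        (λ { fixed y y∈i (_ , refl) → block-moved ¬i y∈i (fixed i) })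
        (Allₚ.all-filter fixed? (allFin n)))) (Allₚ.all-filter nontrivial? (allFin t))))

    cover : ∀ y → Any (y ∈ᵇ_) blocks
    cover y with fixed? y
    ... | yes fixed = Anyₚ.++⁺ʳ (map block cycles) (Anyₚ.map⁺
      (lose (∈-filter⁺ fixed? (∈-allFin y) fixed) (0 , refl)))
    ... | no ¬fixed with i , moved ← ¬∀⟶∃¬ t _ (λ i → σ i ⟨$⟩ʳ y ≟ᶠ y) ¬fixed =
      Anyₚ.++⁺ˡ (Anyₚ.map⁺ (lose
        (∈-filter⁺ nontrivial? (∈-allFin i) (C.moved⇒a-moved i moved)) (C.moved⇒∈ i moved)))

    rotations : All (Rotation G) blocks
    rotations = Allₚ.++⁺
      (Allₚ.map⁺ (All.universal (λ i → record
        { generator = power (SymmetricGroup n) (σ i) (r i)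
        ; member    = proj₂ generated (gen i)
        ; rotates   = C.power-σ^ i (r i)
        ; fixes     = λ y y∉ → power-fixes (σ i) (r i) (outside-fixed i y y∉)
        }) cycles))
      (Allₚ.map⁺ (All.universal (λ y → record
        { generator = Perm.id
        ; member    = ε-closed
        ; rotates   = λ _ → refl
        ; fixes     = λ _ _ → refl
        }) fixedPoints))
      where
      outside-fixed : ∀ i y → ¬ y ∈ᵇ block i → σ i ⟨$⟩ʳ y ≡ y
      outside-fixed i y y∉ with σ i ⟨$⟩ʳ y ≟ᶠ y
      ... | yes fixed = fixed
      ... | no moved  = contradiction (C.moved⇒∈ i moved) y∉

    turns : ∀ {g} → Member g → All (λ b → ∃ λ q → TurnsBy G b q g) blocks
    turns g∈G = Allₚ.++⁺
      (Allₚ.map⁺ (All.map (λ {i} ¬i → turns-generated G (block i) (turns-block i ¬i) (proj₁ generated g∈G))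
        (Allₚ.all-filter nontrivial? (allFin t))))
      (Allₚ.map⁺ (All.map (λ {y} fixed → turns-generated G (fixed-block y)
        (λ i → 0 , λ _ → power-fixes (σ i) (r i) (fixed i)) (proj₁ generated g∈G))
        (Allₚ.all-filter fixed? (allFin n))))
      where
      turns-block : ∀ i → Nontrivial i → ∀ j →
        ∃ λ q → TurnsBy G (block i) q (power (SymmetricGroup n) (σ j) (r j))
      turns-block i ¬i j with i ≟ᶠ j
      ... | yes refl = 1 , λ m → trans (C.power-σ^ i (r i) m)
        (cong (λ s → C.σ^ i (m + s)) (sym (+-identityʳ (C.steps i (r i)))))
      ... | no i≢j = 0 , λ m → trans (power-fixes (σ j) (r j) (other-fixes i≢j ¬i (m , refl)))
        (cong (C.σ^ i) (sym (+-identityʳ m)))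

theorem2p1 : ∀ {p : Level} (n : ℕ) → 1 ≤ n →
    (G : Subgroup (SymmetricGroup n) p) →
    (t : ℕ) (σ : Fin t → Permutation′ n) (r : Fin t → ℤ) →
    (∀ i → IsCycle (σ i)) →
    (∀ i j → i ≢ j → DisjointPermutations (σ i) (σ j)) →
    GeneratedBy (SymmetricGroup n) G (λ i → power (SymmetricGroup n) (σ i) (r i)) →
    SymmetricChainOrder (BooleanQuotient G)
theorem2p1 n _ G t σ r cycle disjoint generated =
  blocks-SCO G apart cover rotations turns
  where open CycleBlocks G t σ r cycle disjoint generated
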